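{- Let $G=(V,E,w)$ be a finite connected graph with $|V|=n\ge2$, weights $w:E\to\mathbb{R}_{>0}$ and total weight $W=\sum_{e\in E}w_e$. Fix $\alpha\in(0,1/2]$ and put $N=n-1$, $q=1-\alpha$, $J=\lfloor\log_{1/q}N\rfloor$. If $\kappa_j(G,w;\alpha)<\infty$ for every $j\in\{0,\ldots,J\}$, then there exists a connected binary hierarchy $T$ on $V$ such that $$\operatorname{cost}_D^-(T)\le W\sum_{j=0}^{J}\kappa_j(G,w;\alpha).$$ Consequently, $$\frac{\operatorname{OPT}_{\mathrm{card}}(G,w)}{\operatorname{OPT}_{\mathrm{free}}(G,w)}\le\sum_{j=0}^{J}\kappa_j(G,w;\alpha).$$
   Context: Fragmentation profile. For $S\subseteq V$ with $G[S]$ connected, $W(S)=\sum_{xy\in E(G[S])}w_{xy}$; for disjoint $A,B\subseteq V$, $w(A,B)$ is the total weight of edges with one endpoint in $A$ and the other in $B$. A connected $\alpha$-balanced fragmentation of $S$ is a bipartition $S=A\mathbin{\dot\cup}B$ with $G[A],G[B]$ connected (nonempty) and $\max\{|A|-1,|B|-1\}\le(1-\alpha)(|S|-1)$. For connected $S$ with $|S|\ge2$, $\operatorname{frag}_\alpha(S)$ is the minimum of $(|S|-1)w(A,B)/W(S)$ over all connected $\alpha$-balanced fragmentations of $S$, and $+\infty$ if there are none. For $j\in\{0,\ldots,J\}$, $\kappa_j(G,w;\alpha)=\sup\{\operatorname{frag}_\alpha(S): S\subseteq V,\ G[S]\text{ connected},\ q^{j+1}N<|S|-1\le q^jN\}$,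 with the supremum over an empty family equal to $0$. Hierarchies and optima. A rooted binary hierarchy $T$ on $V$ is a rooted tree whose leaves are the vertices of $V$ and whose internal nodes have exactly two children; each node is identified with the set of leaves below it (a cluster), and $C_T(x,y)$ is the cluster of the lowest common ancestor of $x,y$. $T$ is connected if every cluster induces a connected subgraph of $G$. $\operatorname{cost}_D^-(T)=\sum_{xy\in E}w_{xy}(|C_T(x,y)|-1)$. $d_G$ is the shortest-path metric of $(V,E)$ with every edge of length $1$. $\operatorname{OPT}_{\mathrm{free}}(G,w)$ is the minimum of $\sum_{xy\in E}w_{xy}u(x,y)$ over all ultrametrics $u$ on $V$ (metrics with $u(x,y)\le\max\{u(x,z),u(z,y)\}$) with $u\ge d_G$ on all pairs. Put $h_H(x,x)=0$, $h_H(x,y)=|C_H(x,y)|-1$ for $x\ne y$; $\operatorname{OPT}_{\mathrm{card}}(G,w)$ is the minimum of $\sum_{xy\in E}w_{xy}h_H(x,y)$ over all rooted binary hierarchies $H$ on $V$ with $h_H\ge d_G$ on all pairs. -}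

module Defs where

open import Algebra.Bundles using (CommutativeRing)
import Algebra.Construct.NaturalChoice.Max as Max
import Algebra.Construct.NaturalChoice.Min as Min
import Algebra.Properties.Monoid.Mult as Mult
import Algebra.Properties.Monoid.Sum as Sum
import Algebra.Properties.Semiring.Exp as Exp
open import Data.Bool.Base using (if_then_else_; true; false)
import Data.Bool.Properties as Bool
open import Data.Fin.Base using (Fin; zero; suc; toℕ)
import Data.Fin.Base as Fin
open import Data.Fin.Properties using (_<?_; _≟_; all?; toℕ-injective; toℕ<n; toℕ-fromℕ<)
open import Data.Fin.Subset using (Subset; ⁅_⁆; _∪_; _∩_; ⊥; ⊤; ∣_∣; _∈_; Nonempty)
open import Data.Fin.Subset.Properties using (_∈?_; nonempty?)
open import Data.List.Base using (List; []; _∷_; _++_; map; filter; foldr; cartesianProduct)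
open import Data.Nat.Base as ℕ using (ℕ; zero; suc; _∸_)
import Data.Nat.Properties as ℕ
open import Data.Product.Base using (∃; _×_; _,_)
open import Data.Sum.Base using (_⊎_; inj₁; inj₂)
open import Data.Vec.Base as Vec using ([]; _∷_)
import Data.Vec.Properties as Vec
import Function.Metric.Structures as Metric
open import Level using (Level; _⊔_; 0ℓ) renaming (suc to lsuc)
open import Relation.Binary.Bundles using (TotalOrder)
open import Relation.Binary.Construct.Add.Supremum.NonStrict using (≤⁺-isTotalOrder)
open import Relation.Binary.Construct.Closure.ReflexiveTransitive using (Star; ε; _◅_; _◅◅_)
import Relation.Binary.Construct.NonStrictToStrict as ToStrict
open import Relation.Binary.Core using (Rel)
open import Relation.Binary.Definitions using (Decidable; Symmetric; Irreflexive)
open import Relation.Binary.PropositionalEquality.Core using (_≡_; refl; sym; trans; subst)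
open import Relation.Binary.Structures using (IsDecTotalOrder)
open import Relation.Nullary.Construct.Add.Supremum using (_⁺; [_]; ⊤⁺)
open import Relation.Nullary.Decidable using (Dec; yes; no; does; map′; _×-dec_; _⊎-dec_; _→-dec_)
open import Relation.Nullary.Negation using (¬_)

private
  variable
    c ℓ₁ ℓ₂ a b : Level
    n : ℕ

record OrderedField c ℓ₁ ℓ₂ : Set (lsuc (c ⊔ ℓ₁ ⊔ ℓ₂)) where
  infix 4 _≤_
  infix 8 _⁻¹
  infixl 7 _÷_
  field
    commutativeRing : CommutativeRing c ℓ₁
  open CommutativeRing commutativeRing public hiding (zero; refl; sym; trans)
  field
    _≤_             : Rel Carrier ℓ₂
    isDecTotalOrder : IsDecTotalOrder _≈_ _≤_
    +-monoʳ-≤       : ∀ x {y z} → y ≤ z → x + y ≤ x + z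
    *-nonNegative   : ∀ {x y} → 0# ≤ x → 0# ≤ y → 0# ≤ x * y
    0≉1             : ¬ (0# ≈ 1#)
    -- The value of 0# ⁻¹ is left unspecified.
    _⁻¹             : Carrier → Carrier
    ⁻¹-inverseʳ     : ∀ x → ¬ (x ≈ 0#) → x * x ⁻¹ ≈ 1#

  open IsDecTotalOrder isDecTotalOrder public using (isTotalOrder; _≤?_)
    renaming (_≟_ to _≈?_)

  open ToStrict _≈_ _≤_ public using (_<_)

  _<ᵣ?_ : Decidable _<_
  _<ᵣ?_ = ToStrict.<-decidable _≈_ _≤_ _≈?_ _≤?_

  _÷_ : Carrier → Carrier → Carrier
  x ÷ y = x * y ⁻¹

  fromℕ : ℕ → Carrier
  fromℕ k = k · 1#
    where open Mult +-monoid using () renaming (_×_ to _·_)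

  open Exp semiring public using (_^_)
  open Sum +-monoid public using (sum)

  totalOrder : TotalOrder c ℓ₁ ℓ₂
  totalOrder = record { isTotalOrder = isTotalOrder }

  open Max totalOrder public using () renaming (_⊔_ to max)

  totalOrder⁺ : TotalOrder _ _ _
  totalOrder⁺ = record { isTotalOrder = ≤⁺-isTotalOrder _≤_ isTotalOrder }

  open Max totalOrder⁺ public using () renaming (_⊔_ to max⁺)
  open Min totalOrder⁺ public using () renaming (_⊓_ to min⁺)

  Finite : Carrier ⁺ → Set c
  Finite x = ∃ λ r → x ≡ [ r ]

  minimum⁺ : List (Carrier ⁺) → Carrier ⁺
  minimum⁺ = foldr min⁺ ⊤⁺

  -- The suprema taken below are of families of nonnegative values; the
  -- empty family has supremum 0.
  supremum⁺ : List (Carrier ⁺) → Carrier ⁺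
  supremum⁺ []       = [ 0# ]
  supremum⁺ (x ∷ xs) = foldr max⁺ x xs

  -- For b > 1 and x ≥ 1 this says J ≤ log_b x < J + 1, that is,
  -- J = ⌊ log_b x ⌋.
  IsFloorLog : Carrier → Carrier → ℕ → Set (ℓ₁ ⊔ ℓ₂)
  IsFloorLog b x J = b ^ J ≤ x × x < b ^ suc J

  IsMinimum : {A : Set a} → (A → Set b) → (A → Carrier) → Carrier → Set (a ⊔ b ⊔ ℓ₁ ⊔ ℓ₂)
  IsMinimum Feasible value m =
    (∃ λ x → Feasible x × value x ≈ m) × (∀ x → Feasible x → m ≤ value x)

-- The real numbers, given by their axiomatic characterisation as the
-- (unique up to isomorphism) Dedekind-complete ordered field.
record RealField c ℓ₁ ℓ₂ : Set (lsuc (c ⊔ ℓ₁ ⊔ ℓ₂)) where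
  field
    orderedField : OrderedField c ℓ₁ ℓ₂
  open OrderedField orderedField public

  _IsUpperBoundOf_ : Carrier → (Carrier → Set (c ⊔ ℓ₁ ⊔ ℓ₂)) → Set (c ⊔ ℓ₁ ⊔ ℓ₂)
  u IsUpperBoundOf P = ∀ x → P x → x ≤ u

  field
    complete : (P : Carrier → Set (c ⊔ ℓ₁ ⊔ ℓ₂)) →
               ∃ P → (∃ λ u → u IsUpperBoundOf P) →
               ∃ λ s → s IsUpperBoundOf P × (∀ u → u IsUpperBoundOf P → s ≤ u)

module Reachability {R : Rel (Fin n) 0ℓ} (R? : Decidable R) where

  -- Reach k x y: there is a walk from x to y all of whose intermediate
  -- vertices have index below k.
  Reach : (k : ℕ) → k ℕ.≤ n → Rel (Fin n) 0ℓ
  Reach zero    _   x y = x ≡ y ⊎ R x y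
  Reach (suc k) k<n x y = Reach k (ℕ.<⇒≤ k<n) x y ⊎
    (Reach k (ℕ.<⇒≤ k<n) x (Fin.fromℕ< k<n) × Reach k (ℕ.<⇒≤ k<n) (Fin.fromℕ< k<n) y)

  reach? : ∀ k k≤n → Decidable (Reach k k≤n)
  reach? zero    _   x y = (x ≟ y) ⊎-dec R? x y
  reach? (suc k) k<n x y = reach? k _ x y ⊎-dec (reach? k _ x _ ×-dec reach? k _ _ y)

  sound : ∀ k k≤n {x y} → Reach k k≤n x y → Star R x y
  sound zero    _ (inj₁ refl)    = ε
  sound zero    _ (inj₂ r)       = r ◅ ε
  sound (suc k) _ (inj₁ r)       = sound k _ r
  sound (suc k) _ (inj₂ (r , s)) = sound k _ r ◅◅ sound k _ s

  base : ∀ k k≤n {x y} → x ≡ y ⊎ R x y → Reach k k≤n x y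
  base zero    _ r = r
  base (suc k) _ r = inj₁ (base k _ r)

  compose : ∀ k k≤n {x v y} → toℕ v ℕ.< k →
            Reach k k≤n x v → Reach k k≤n v y → Reach k k≤n x y
  compose (suc k) k<n {x} {v} {y} v<1+k r s with ℕ.m≤n⇒m<n∨m≡n (ℕ.s≤s⁻¹ v<1+k)
  ... | inj₁ v<k = via r s
    where
    via : Reach (suc k) k<n x v → Reach (suc k) k<n v y → Reach (suc k) k<n x y
    via (inj₁ xv)       (inj₁ vy)       = inj₁ (compose k _ v<k xv vy)
    via (inj₁ xv)       (inj₂ (vk , ky)) = inj₂ (compose k _ v<k xv vk , ky)
    via (inj₂ (xk , kv)) (inj₁ vy)       = inj₂ (xk , compose k _ v<k kv vy)
    via (inj₂ (xk , _)) (inj₂ (_ , ky)) = inj₂ (xk , ky)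
  ... | inj₂ v≡k = inj₂ (into r , from s)
    where
    v≡ : v ≡ Fin.fromℕ< k<n
    v≡ = toℕ-injective (trans v≡k (sym (toℕ-fromℕ< k<n)))
    into : Reach (suc k) k<n x v → Reach k _ x (Fin.fromℕ< k<n)
    into (inj₁ xv)       = subst (Reach k _ x) v≡ xv
    into (inj₂ (xk , _)) = xk
    from : Reach (suc k) k<n v y → Reach k _ (Fin.fromℕ< k<n) y
    from (inj₁ vy)       = subst (λ z → Reach k _ z y) v≡ vy
    from (inj₂ (_ , ky)) = ky

  complete : ∀ {x y} → Star R x y → Reach n ℕ.≤-refl x y
  complete ε        = base n _ (inj₁ refl)
  complete (r ◅ rs) = compose n _ (toℕ<n _) (base n _ (inj₂ r)) (complete rs)

  star? : Decidable (Star R)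
  star? x y = map′ (sound n _) complete (reach? n ℕ.≤-refl x y)

subsets : ∀ n → List (Subset n)
subsets zero    = [] ∷ []
subsets (suc n) = map (true ∷_) (subsets n) ++ map (false ∷_) (subsets n)

IsBipartition : Subset n → Subset n → Subset n → Set
IsBipartition S A B = A ∪ B ≡ S × A ∩ B ≡ ⊥

isBipartition? : (S A B : Subset n) → Dec (IsBipartition S A B)
isBipartition? S A B = Vec.≡-dec Bool._≟_ (A ∪ B) S ×-dec Vec.≡-dec Bool._≟_ (A ∩ B) ⊥

-- The rooted binary hierarchies with leaf set S; the index is the
-- cluster of the root.
data Hierarchy {n} (S : Subset n) : Set where
  leaf : ∀ v → S ≡ ⁅ v ⁆ → Hierarchy S
  node : ∀ {A B} → IsBipartition S A B → Hierarchy A → Hierarchy B → Hierarchy S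

-- Only meaningful for x, y ∈ S.
lcaCluster : {S : Subset n} → Hierarchy S → Fin n → Fin n → Subset n
lcaCluster {S = S} (leaf _ _) x y = S
lcaCluster {S = S} (node {A} {B} _ H K) x y =
  if does (x ∈? A ×-dec y ∈? A) then lcaCluster H x y else
  if does (x ∈? B ×-dec y ∈? B) then lcaCluster K x y else S

height : {S : Subset n} → Hierarchy S → Fin n → Fin n → ℕ
height H x y = if does (x ≟ y) then 0 else ∣ lcaCluster H x y ∣ ∸ 1

EveryCluster : (Subset n → Set) → {S : Subset n} → Hierarchy S → Set
EveryCluster P {S} (leaf _ _)   = P S
EveryCluster P {S} (node _ H K) = P S × EveryCluster P H × EveryCluster P K

data Walk {n} (_~_ : Rel (Fin n) 0ℓ) : ℕ → Rel (Fin n) 0ℓ where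
  stop : ∀ {x} → Walk _~_ 0 x x
  step : ∀ {k x y z} → x ~ y → Walk _~_ k y z → Walk _~_ (suc k) x z

module _ (K : OrderedField c ℓ₁ ℓ₂) where
  open OrderedField K

  record WeightedGraph (n : ℕ) : Set (c ⊔ ℓ₁ ⊔ ℓ₂ ⊔ lsuc 0ℓ) where
    infix 4 _~_ _~?_
    field
      _~_        : Rel (Fin n) 0ℓ
      _~?_       : Decidable _~_
      ~-irrefl   : Irreflexive _≡_ _~_
      ~-sym      : Symmetric _~_
      weight     : ∀ {x y} → x ~ y → Carrier
      weight-sym : ∀ {x y} (e : x ~ y) (e′ : y ~ x) → weight e ≈ weight e′
      weight-pos : ∀ {x y} (e : x ~ y) → 0# < weight e

module _ {K : OrderedField c ℓ₁ ℓ₂} (G : WeightedGraph K n) where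
  open OrderedField K
  open WeightedGraph G

  Induced : Subset n → Rel (Fin n) 0ℓ
  Induced S x y = x ∈ S × y ∈ S × x ~ y

  induced? : ∀ S → Decidable (Induced S)
  induced? S x y = x ∈? S ×-dec y ∈? S ×-dec x ~? y

  Connected : Subset n → Set
  Connected S = Nonempty S × (∀ x y → x ∈ S → y ∈ S → Star (Induced S) x y)

  connected? : ∀ S → Dec (Connected S)
  connected? S = nonempty? S ×-dec
    all? λ x → all? λ y → (x ∈? S) →-dec ((y ∈? S) →-dec Reachability.star? (induced? S) x y)

  -- Weights are extended by zero to non-adjacent pairs, so that sums over
  -- edges can be written as sums over pairs of vertices.
  w : Fin n → Fin n → Carrier
  w x y with x ~? y
  ... | yes e = weight e
  ... | no  _ = 0#

  -- Σ w_xy · f(x,y) over the edges xy with both ends in S; each edge is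
  -- counted once, as the pair with x < y.
  edgeSum : Subset n → (Fin n → Fin n → Carrier) → Carrier
  edgeSum S f = sum λ x → sum λ y →
    if does (x <? y ×-dec x ∈? S ×-dec y ∈? S) then w x y * f x y else 0#

  inner : Subset n → Carrier
  inner S = edgeSum S λ _ _ → 1#

  cut : Subset n → Subset n → Carrier
  cut A B = sum λ x → sum λ y →
    if does (x ∈? A ×-dec y ∈? B) then w x y else 0#

  totalWeight : Carrier
  totalWeight = inner ⊤

  size-1 : Subset n → Carrier
  size-1 S = fromℕ (∣ S ∣ ∸ 1)

  module _ (α : Carrier) where

    IsFragmentation : Subset n → Subset n × Subset n → Set ℓ₂
    IsFragmentation S (A , B) =
      IsBipartition S A B × Connected A × Connected B ×
      max (size-1 A) (size-1 B) ≤ (1# - α) * size-1 S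

    isFragmentation? : ∀ S AB → Dec (IsFragmentation S AB)
    isFragmentation? S (A , B) =
      isBipartition? S A B ×-dec connected? A ×-dec connected? B ×-dec (_ ≤? _)

    frag : Subset n → Carrier ⁺
    frag S = minimum⁺ (map (λ (A , B) → [ (size-1 S * cut A B) ÷ inner S ])
      (filter (isFragmentation? S) (cartesianProduct (subsets n) (subsets n))))

    InScale : ℕ → Subset n → Set (ℓ₁ ⊔ ℓ₂)
    InScale j S = Connected S ×
      (1# - α) ^ suc j * fromℕ (n ∸ 1) < size-1 S × size-1 S ≤ (1# - α) ^ j * fromℕ (n ∸ 1)

    inScale? : ∀ j S → Dec (InScale j S)
    inScale? j S = connected? S ×-dec (_ <ᵣ? _) ×-dec (_ ≤? _)

    κ : ℕ → Carrier ⁺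
    κ j = supremum⁺ (map frag (filter (inScale? j) (subsets n)))

  IsConnectedHierarchy : Hierarchy {n} ⊤ → Set
  IsConnectedHierarchy = EveryCluster Connected

  cost : Hierarchy {n} ⊤ → Carrier
  cost T = edgeSum ⊤ λ x y → size-1 (lcaCluster T x y)

  IsDistance : Fin n → Fin n → ℕ → Set
  IsDistance x y d = Walk _~_ d x y × (∀ k → Walk _~_ k x y → d ℕ.≤ k)

  DominatesDistance : (Fin n → Fin n → Carrier) → Set ℓ₂
  DominatesDistance u = ∀ x y d → IsDistance x y d → fromℕ d ≤ u x y

  -- The strong triangle inequality and nonnegativity imply the usual
  -- triangle inequality.
  IsUltrametric : (Fin n → Fin n → Carrier) → Set (c ⊔ ℓ₁ ⊔ ℓ₂)
  IsUltrametric = IsGeneralMetric max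
    where open Metric {A = Fin n} _≡_ _≈_ _≤_ 0# using (IsGeneralMetric)

  IsOPTfree : Carrier → Set (c ⊔ ℓ₁ ⊔ ℓ₂)
  IsOPTfree = IsMinimum (λ u → IsUltrametric u × DominatesDistance u) (edgeSum ⊤)

  heightᵣ : Hierarchy {n} ⊤ → Fin n → Fin n → Carrier
  heightᵣ H x y = fromℕ (height H x y)

  IsOPTcard : Carrier → Set (ℓ₁ ⊔ ℓ₂)
  IsOPTcard = IsMinimum (λ H → DominatesDistance (heightᵣ H)) (λ H → edgeSum ⊤ (heightᵣ H))

module Submission where

-- Write W(S) for the weight of the edges inside S, q = 1 - α and N = n - 1.
-- The hierarchy T arises by splitting clusters recursively along optimal
-- fragmentations. A connected cluster S with at least two vertices satisfies
-- q^(j+1) N < |S| - 1 ≤ q^j N for some j ≤ J, and since κ_j is finite it has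
-- a balanced fragmentation into connected parts A and B with
-- (|S| - 1) w(A,B) ≤ κ_j W(S). The pairs separated by this split have S as
-- their least common cluster, so the left side is exactly what the split
-- contributes to the cost (subtreeCost-node). Balance makes |A| - 1 and
-- |B| - 1 at most q^(j+1) N, so that both parts belong to later scales, and
-- W(A) + W(B) ≤ W(S). Induction over the scales, from the last one upwards,
-- therefore bounds the cost below S by W(S) Σ_{i ≥ j} κ_i
-- (hierarchy-below). The induction starts at j = J + 1, where
-- q^(J+1) N < 1 leaves only single vertices.
--
-- For the ratio, a connected cluster with k vertices contains a path of
-- length at most k - 1 between any two of its vertices, so the heights of T
-- dominate the graph distance and OPTcard ≤ cost(T) ≤ W(V) Σ κ_j. An
-- ultrametric dominating the distance is at least 1 on every edge, so
-- W(V) ≤ OPTfree.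
--
-- Both optima are attained because finitely many competitors suffice. There
-- are only finitely many hierarchies on V. For an ultrametric u ≥ d, the
-- function min(n - 1, ⌊u⌋) is again an ultrametric, still dominates the
-- integer-valued d ≤ n - 1, and is at most u (floor-admissible); so the
-- infimum over all ultrametrics is one over finitely many tables of integers.

open import Defs
import Algebra.Construct.NaturalChoice.Max as Max
import Algebra.Properties.Ring as RingProperties
import Algebra.Properties.Semiring.Sum as SemiringSum
open import Data.Bool.Base using (Bool; true; false; _∧_; _∨_; if_then_else_)
import Data.Bool.Properties as Bool
open import Data.Fin.Base using (Fin; zero; suc; toℕ) renaming (_<_ to _<F_)
open import Data.Fin.Properties as Fin using (_≟_; _<?_; any?; all?)
open import Data.Fin.Subset
  using (Subset; ⊤; ⁅_⁆; _∈_; _∉_; _⊆_; _⊂_; ∣_∣; Nonempty)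
  renaming (_-_ to _∖_)
open import Data.Fin.Subset.Properties
open import Data.List.Base
  using (List; []; _∷_; _++_; allFin; cartesianProduct; cartesianProductWith; concatMap; filter; map; upTo)
open import Data.List.Extrema using (argmin; argmin-all; f[argmin]≤f[xs])
open import Data.List.Membership.Propositional as List using (lose)
open import Data.List.Membership.Propositional.Properties
  using ( ∈-++⁺ˡ; ∈-++⁺ʳ; ∈-allFin; ∈-cartesianProduct⁺; ∈-cartesianProductWith⁺; ∈-concatMap⁺
        ; ∈-filter⁺; ∈-map⁺; ∈-map∘filter⁺; ∈-map∘filter⁻; ∈-upTo⁺)
open import Data.List.Relation.Unary.All as All using (All; []; _∷_)
open import Data.List.Relation.Unary.All.Properties using (all-filter)
open import Data.List.Relation.Unary.Any using (here; there)
open import Data.Nat.Base as ℕ using (ℕ; zero; suc; _∸_; z≤n; s≤s) renaming (_≤_ to _≤ℕ_)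
import Data.Nat.Properties as ℕ
open import Data.Product.Base using (∃; ∃₂; _×_; _,_; proj₁; proj₂)
open import Data.Sum.Base using (_⊎_; inj₁; inj₂)
open import Data.Vec.Base using ([]; _∷_; there)
open import Data.Vec.Functional using () renaming (_∷_ to _∷ᶠ_)
import Data.Vec.Properties as Vec
open import Function.Base using (_∘_)
open import Function.Bundles using (mk⇔)
import Function.Metric.Structures as Metric
open import Level using (0ℓ)
open import Relation.Binary.Bundles using (TotalOrder)
open import Relation.Binary.Construct.Add.Supremum.NonStrict using (_≤⊤⁺) renaming ([_] to [_]≤)
open import Relation.Binary.Construct.Closure.ReflexiveTransitive using (Star; ε; _◅_)
open import Relation.Binary.Core using (Rel; REL)
import Relation.Binary.Definitions as B
open import Relation.Binary.PropositionalEquality.Core as ≡ using (_≡_; _≢_; refl)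
import Relation.Binary.PropositionalEquality.Properties as ≡
import Relation.Binary.Reasoning.PartialOrder as PartialOrderReasoning
open import Relation.Nullary.Construct.Add.Supremum using (_⁺; [_])
open import Relation.Nullary.Decidable
  using ( Dec; yes; no; does; map′; ¬?; _×-dec_; _⊎-dec_; _→-dec_
        ; dec-true; dec-false; dec-yes-irr; does-⇔)
open import Relation.Nullary.Negation using (¬_; contradiction)
open import Relation.Unary using (Pred; Decidable)

-- Ordered fields

module OrderedFieldProperties {c ℓ₁ ℓ₂} (K : OrderedField c ℓ₁ ℓ₂) where

  open OrderedField K
  open TotalOrder totalOrder public
    using (poset)
    renaming ( refl to ≤-refl; trans to ≤-trans; reflexive to ≤-reflexive
             ; antisym to ≤-antisym; total to ≤-total)
  open SemiringSum semiring public
    using (sum-cong-≋; ∑-distrib-+; ∑-comm; *-distribˡ-sum; sum-replicate-zero)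
  open RingProperties ring using (-‿distribʳ-*)

  module ≤-Reasoning = PartialOrderReasoning poset

  module ≈ = TotalOrder.Eq totalOrder

  open ≤-Reasoning

  +-mono-≤ : ∀ {x y u v} → x ≤ y → u ≤ v → x + u ≤ y + v
  +-mono-≤ {x} {y} {u} {v} x≤y u≤v = begin
    x + u ≤⟨ +-monoʳ-≤ x u≤v ⟩
    x + v ≈⟨ +-comm x v ⟩
    v + x ≤⟨ +-monoʳ-≤ v x≤y ⟩
    v + y ≈⟨ +-comm v y ⟩
    y + v ∎

  +-nonNegative : ∀ {x y} → 0# ≤ x → 0# ≤ y → 0# ≤ x + y
  +-nonNegative {x} {y} 0≤x 0≤y = begin
    0#      ≈⟨ +-identityˡ 0# ⟨
    0# + 0# ≤⟨ +-mono-≤ 0≤x 0≤y ⟩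
    x + y   ∎

  x≤x+y : ∀ {x y} → 0# ≤ y → x ≤ x + y
  x≤x+y {x} {y} 0≤y = begin
    x      ≈⟨ +-identityʳ x ⟨
    x + 0# ≤⟨ +-monoʳ-≤ x 0≤y ⟩
    x + y  ∎

  x≤y+x : ∀ {x y} → 0# ≤ y → x ≤ y + x
  x≤y+x {x} {y} 0≤y = ≤-trans (x≤x+y 0≤y) (≤-reflexive (+-comm x y))

  x≤y⇒0≤y-x : ∀ {x y} → x ≤ y → 0# ≤ y - x
  x≤y⇒0≤y-x {x} {y} x≤y = begin
    0#      ≈⟨ -‿inverseˡ x ⟨
    - x + x ≤⟨ +-monoʳ-≤ (- x) x≤y ⟩
    - x + y ≈⟨ +-comm (- x) y ⟩
    y - x   ∎

  x+[y-x]≈y : ∀ x y → x + (y - x) ≈ y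
  x+[y-x]≈y x y = begin-equality
    x + (y - x)   ≈⟨ +-congˡ (+-comm y (- x)) ⟩
    x + (- x + y) ≈⟨ +-assoc x (- x) y ⟨
    x - x + y     ≈⟨ +-congʳ (-‿inverseʳ x) ⟩
    0# + y        ≈⟨ +-identityˡ y ⟩
    y             ∎

  *-monoˡ-≤ : ∀ {x y z} → 0# ≤ x → y ≤ z → x * y ≤ x * z
  *-monoˡ-≤ {x} {y} {z} 0≤x y≤z = begin
    x * y               ≤⟨ x≤x+y (*-nonNegative 0≤x (x≤y⇒0≤y-x y≤z)) ⟩
    x * y + x * (z - y) ≈⟨ distribˡ x y (z - y) ⟨
    x * (y + (z - y))   ≈⟨ *-congˡ (x+[y-x]≈y y z) ⟩
    x * z               ∎

  *-monoʳ-≤ : ∀ {x y z} → 0# ≤ x → y ≤ z → y * x ≤ z * x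
  *-monoʳ-≤ {x} {y} {z} 0≤x y≤z = begin
    y * x ≈⟨ *-comm y x ⟩
    x * y ≤⟨ *-monoˡ-≤ 0≤x y≤z ⟩
    x * z ≈⟨ *-comm x z ⟩
    z * x ∎

  -- Were 1 ≤ 0, then 0 ≤ -1 and hence 0 ≤ (-1)(-1) = 1 all the same.
  0≤1 : 0# ≤ 1#
  0≤1 with ≤-total 0# 1#
  ... | inj₁ 0≤1 = 0≤1
  ... | inj₂ 1≤0 = begin
    0#                     ≤⟨ *-nonNegative 0≤-1 0≤-1 ⟩
    - 1# * - 1#            ≈⟨ -‿distribʳ-* (- 1#) 1# ⟨
    - (- 1# * 1#)          ≈⟨ -‿cong (*-identityʳ (- 1#)) ⟩
    - - 1#                 ≈⟨ +-identityˡ (- - 1#) ⟨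
    0# - - 1#              ≈⟨ +-congʳ (-‿inverseʳ 1#) ⟨
    (1# - 1#) - - 1#       ≈⟨ +-assoc 1# (- 1#) (- - 1#) ⟩
    1# + (- 1# - - 1#)     ≈⟨ +-congˡ (-‿inverseʳ (- 1#)) ⟩
    1# + 0#                ≈⟨ +-identityʳ 1# ⟩
    1#                     ∎
    where
    0≤-1 : 0# ≤ - 1#
    0≤-1 = ≤-trans (x≤y⇒0≤y-x 1≤0) (≤-reflexive (+-identityˡ (- 1#)))

  1≰0 : ¬ (1# ≤ 0#)
  1≰0 1≤0 = 0≉1 (≤-antisym 0≤1 1≤0)

  1≤⇒0< : ∀ {x} → 1# ≤ x → 0# < x
  1≤⇒0< 1≤x = ≤-trans 0≤1 1≤x , λ 0≈x → 1≰0 (≤-trans 1≤x (≤-reflexive (≈.sym 0≈x)))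

  <-≤-trans : ∀ {x y z} → x < y → y ≤ z → x < z
  <-≤-trans {x} {y} {z} x<y y≤z = begin-strict
    x <⟨ x<y ⟩
    y ≤⟨ y≤z ⟩
    z ∎

  ≤-<-trans : ∀ {x y z} → x ≤ y → y < z → x < z
  ≤-<-trans {x} {y} {z} x≤y y<z = begin-strict
    x ≤⟨ x≤y ⟩
    y <⟨ y<z ⟩
    z ∎

  <⇒≱ : ∀ {x y} → x < y → ¬ (y ≤ x)
  <⇒≱ (x≤y , x≉y) y≤x = x≉y (≤-antisym x≤y y≤x)

  ≰⇒> : ∀ {x y} → ¬ (x ≤ y) → y < x
  ≰⇒> {x} {y} x≰y with ≤-total x y
  ... | inj₁ x≤y = contradiction x≤y x≰y
  ... | inj₂ y≤x = y≤x , λ y≈x → x≰y (≤-reflexive (≈.sym y≈x))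

  0<⇒≉0 : ∀ {x} → 0# < x → ¬ (x ≈ 0#)
  0<⇒≉0 (_ , 0≉x) x≈0 = 0≉x (≈.sym x≈0)

  ⁻¹-inverseˡ : ∀ {x} → 0# < x → x ⁻¹ * x ≈ 1#
  ⁻¹-inverseˡ {x} 0<x = ≈.trans (*-comm (x ⁻¹) x) (⁻¹-inverseʳ x (0<⇒≉0 0<x))

  ⁻¹-nonNegative : ∀ {x} → 0# < x → 0# ≤ x ⁻¹
  ⁻¹-nonNegative {x} 0<x with ≤-total 0# (x ⁻¹)
  ... | inj₁ 0≤x⁻¹ = 0≤x⁻¹
  ... | inj₂ x⁻¹≤0 = contradiction 1≤0 1≰0
    where
    1≤0 : 1# ≤ 0#
    1≤0 = begin
      1#       ≈⟨ ⁻¹-inverseʳ x (0<⇒≉0 0<x) ⟨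
      x * x ⁻¹ ≤⟨ *-monoˡ-≤ (proj₁ 0<x) x⁻¹≤0 ⟩
      x * 0#   ≈⟨ zeroʳ x ⟩
      0#       ∎

  ÷-nonNegative : ∀ {x y} → 0# ≤ x → 0# < y → 0# ≤ x ÷ y
  ÷-nonNegative 0≤x 0<y = *-nonNegative 0≤x (⁻¹-nonNegative 0<y)

  x≤z*y⇒x÷y≤z : ∀ {x y z} → 0# < y → x ≤ z * y → x ÷ y ≤ z
  x≤z*y⇒x÷y≤z {x} {y} {z} 0<y x≤zy = begin
    x * y ⁻¹       ≤⟨ *-monoʳ-≤ (⁻¹-nonNegative 0<y) x≤zy ⟩
    z * y * y ⁻¹   ≈⟨ *-assoc z y (y ⁻¹) ⟩
    z * (y * y ⁻¹) ≈⟨ *-congˡ (⁻¹-inverseʳ y (0<⇒≉0 0<y)) ⟩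
    z * 1#         ≈⟨ *-identityʳ z ⟩
    z              ∎

  x÷y≤z⇒x≤y*z : ∀ {x y z} → 0# < y → x ÷ y ≤ z → x ≤ y * z
  x÷y≤z⇒x≤y*z {x} {y} {z} 0<y x÷y≤z = begin
    x              ≈⟨ *-identityʳ x ⟨
    x * 1#         ≈⟨ *-congˡ (⁻¹-inverseˡ 0<y) ⟨
    x * (y ⁻¹ * y) ≈⟨ *-assoc x (y ⁻¹) y ⟨
    x ÷ y * y      ≤⟨ *-monoʳ-≤ (proj₁ 0<y) x÷y≤z ⟩
    z * y          ≈⟨ *-comm z y ⟩
    y * z          ∎

  ^-nonNegative : ∀ {x} k → 0# ≤ x → 0# ≤ x ^ k
  ^-nonNegative zero    0≤x = 0≤1
  ^-nonNegative (suc k) 0≤x = *-nonNegative 0≤x (^-nonNegative k 0≤x)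

  ^-inverse : ∀ {x} k → 0# < x → (x ⁻¹) ^ k * x ^ k ≈ 1#
  ^-inverse         zero    0<x = *-identityʳ 1#
  ^-inverse {x} (suc k) 0<x = begin-equality
    b * b ^ k * (x * x ^ k)   ≈⟨ *-assoc b (b ^ k) (x * x ^ k) ⟩
    b * (b ^ k * (x * x ^ k)) ≈⟨ *-congˡ (*-assoc (b ^ k) x (x ^ k)) ⟨
    b * (b ^ k * x * x ^ k)   ≈⟨ *-congˡ (*-congʳ (*-comm (b ^ k) x)) ⟩
    b * (x * b ^ k * x ^ k)   ≈⟨ *-congˡ (*-assoc x (b ^ k) (x ^ k)) ⟩
    b * (x * (b ^ k * x ^ k)) ≈⟨ *-congˡ (*-congˡ (^-inverse k 0<x)) ⟩
    b * (x * 1#)              ≈⟨ *-congˡ (*-identityʳ x) ⟩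
    b * x                     ≈⟨ ⁻¹-inverseˡ 0<x ⟩
    1#                        ∎
    where b = x ⁻¹

  <[x⁻¹]^k⇒x^k*y<1 : ∀ {x y} k → 0# < x → y < (x ⁻¹) ^ k → x ^ k * y < 1#
  <[x⁻¹]^k⇒x^k*y<1 {x} {y} k 0<x y<b^k = ≰⇒> λ 1≤x^k*y → <⇒≱ y<b^k (begin
    (x ⁻¹) ^ k               ≈⟨ *-identityʳ ((x ⁻¹) ^ k) ⟨
    (x ⁻¹) ^ k * 1#          ≤⟨ *-monoˡ-≤ (^-nonNegative k (⁻¹-nonNegative 0<x)) 1≤x^k*y ⟩
    (x ⁻¹) ^ k * (x ^ k * y) ≈⟨ *-assoc ((x ⁻¹) ^ k) (x ^ k) y ⟨
    (x ⁻¹) ^ k * x ^ k * y   ≈⟨ *-congʳ (^-inverse k 0<x) ⟩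
    1# * y                   ≈⟨ *-identityˡ y ⟩
    y                        ∎)

  fromℕ-nonNegative : ∀ k → 0# ≤ fromℕ k
  fromℕ-nonNegative zero    = ≤-refl
  fromℕ-nonNegative (suc k) = +-nonNegative 0≤1 (fromℕ-nonNegative k)

  fromℕ-mono-≤ : ∀ {k l} → k ≤ℕ l → fromℕ k ≤ fromℕ l
  fromℕ-mono-≤ {l = l} z≤n = fromℕ-nonNegative l
  fromℕ-mono-≤ (s≤s k≤l)   = +-monoʳ-≤ 1# (fromℕ-mono-≤ k≤l)

  1≤fromℕ-suc : ∀ k → 1# ≤ fromℕ (suc k)
  1≤fromℕ-suc k = x≤x+y (fromℕ-nonNegative k)

  fromℕ<1⇒≡0 : ∀ {k} → fromℕ k < 1# → k ≡ 0
  fromℕ<1⇒≡0 {zero}  _   = ≡.refl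
  fromℕ<1⇒≡0 {suc k} k<1 = contradiction (1≤fromℕ-suc k) (<⇒≱ k<1)

  ½<1 : fromℕ 2 ⁻¹ < 1#
  ½<1 = ≰⇒> λ 1≤½ → 1≰0 (begin
    1#                  ≈⟨ +-identityʳ 1# ⟨
    1# + 0#             ≈⟨ +-identityˡ (1# + 0#) ⟨
    0# + (1# + 0#)      ≈⟨ +-congʳ (-‿inverseˡ 1#) ⟨
    - 1# + 1# + (1# + 0#) ≈⟨ +-assoc (- 1#) 1# (1# + 0#) ⟩
    - 1# + fromℕ 2      ≤⟨ +-monoʳ-≤ (- 1#) (begin
      fromℕ 2              ≈⟨ *-identityʳ (fromℕ 2) ⟨
      fromℕ 2 * 1#         ≤⟨ *-monoˡ-≤ (fromℕ-nonNegative 2) 1≤½ ⟩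
      fromℕ 2 * fromℕ 2 ⁻¹ ≈⟨ ⁻¹-inverseʳ (fromℕ 2) (0<⇒≉0 (1≤⇒0< (1≤fromℕ-suc 1))) ⟩
      1#                   ∎) ⟩
    - 1# + 1#           ≈⟨ -‿inverseˡ 1# ⟩
    0#                  ∎)

  x<1⇒0<1-x : ∀ {x} → x < 1# → 0# < 1# - x
  x<1⇒0<1-x {x} x<1 = ≰⇒> λ 1-x≤0 → <⇒≱ x<1 (begin
    1#           ≈⟨ x+[y-x]≈y x 1# ⟨
    x + (1# - x) ≤⟨ +-monoʳ-≤ x 1-x≤0 ⟩
    x + 0#       ≈⟨ +-identityʳ x ⟩
    x            ∎)

  -- min(m, ⌊x⌋) for x ≥ 0, found by searching downwards from m; the cap
  -- makes it computable without the Archimedean property.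
  floor : ℕ → Carrier → ℕ
  floor zero    x = 0
  floor (suc m) x = if does (fromℕ (suc m) ≤? x) then suc m else floor m x

  floor≤ : ∀ m x → floor m x ≤ℕ m
  floor≤ zero    x = z≤n
  floor≤ (suc m) x with fromℕ (suc m) ≤? x
  ... | yes _ = ℕ.≤-refl
  ... | no _  = ℕ.m≤n⇒m≤1+n (floor≤ m x)

  fromℕ-floor≤ : ∀ m {x} → 0# ≤ x → fromℕ (floor m x) ≤ x
  fromℕ-floor≤ zero    0≤x = 0≤x
  fromℕ-floor≤ (suc m) {x} 0≤x with fromℕ (suc m) ≤? x
  ... | yes 1+m≤x = 1+m≤x
  ... | no _      = fromℕ-floor≤ m 0≤x

  ≤floor : ∀ {m k x} → k ≤ℕ m → fromℕ k ≤ x → k ≤ℕ floor m x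
  ≤floor {zero}          k≤0 _ = k≤0
  ≤floor {suc m} {k} {x} k≤1+m k≤x with fromℕ (suc m) ≤? x
  ... | yes _ = k≤1+m
  ... | no 1+m≰x with ℕ.m≤n⇒m<n∨m≡n k≤1+m
  ...   | inj₁ k<1+m = ≤floor (ℕ.s≤s⁻¹ k<1+m) k≤x
  ...   | inj₂ refl  = contradiction k≤x 1+m≰x

  sum-mono-≤ : ∀ {n} {f g : Fin n → Carrier} → (∀ i → f i ≤ g i) → sum f ≤ sum g
  sum-mono-≤ {zero}  f≤g = ≤-refl
  sum-mono-≤ {suc n} f≤g = +-mono-≤ (f≤g zero) (sum-mono-≤ λ i → f≤g (suc i))

  sum-nonNegative : ∀ {n} {f : Fin n → Carrier} → (∀ i → 0# ≤ f i) → 0# ≤ sum f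
  sum-nonNegative {zero}  0≤f = ≤-refl
  sum-nonNegative {suc n} 0≤f = +-nonNegative (0≤f zero) (sum-nonNegative λ i → 0≤f (suc i))

  term≤sum : ∀ {n} {f : Fin n → Carrier} → (∀ i → 0# ≤ f i) → ∀ i → f i ≤ sum f
  term≤sum {suc n} 0≤f zero    = x≤x+y (sum-nonNegative λ i → 0≤f (suc i))
  term≤sum {suc n} 0≤f (suc i) = ≤-trans (term≤sum (λ i → 0≤f (suc i)) i) (x≤y+x (0≤f zero))

  private module Max⁺ = Max totalOrder⁺
  open TotalOrder totalOrder⁺ public using () renaming (_≤_ to infix 4 _≤⁺_; refl to ≤⁺-refl; trans to ≤⁺-trans; total to ≤⁺-total)

  minimum⁺-attained : ∀ xs {r} → minimum⁺ xs ≡ [ r ] → [ r ] List.∈ xs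
  minimum⁺-attained (x ∷ xs) eq with ≤⁺-total x (minimum⁺ xs)
  ... | inj₁ _ = here (≡.sym eq)
  ... | inj₂ _ = there (minimum⁺-attained xs eq)

  minimum⁺-nonNegative : ∀ {xs} → All ([ 0# ] ≤⁺_) xs → [ 0# ] ≤⁺ minimum⁺ xs
  minimum⁺-nonNegative [] = [ 0# ] ≤⊤⁺
  minimum⁺-nonNegative {x ∷ xs} (0≤x ∷ 0≤xs) with ≤⁺-total x (minimum⁺ xs)
  ... | inj₁ _ = 0≤x
  ... | inj₂ _ = minimum⁺-nonNegative 0≤xs

  supremum⁺-upper : ∀ {xs x} → x List.∈ xs → x ≤⁺ supremum⁺ xs
  supremum⁺-upper {x ∷ xs} (here ≡.refl) = head≤ xs
    where
    head≤ : ∀ ys → x ≤⁺ supremum⁺ (x ∷ ys)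
    head≤ []       = ≤⁺-refl
    head≤ (y ∷ ys) = ≤⁺-trans (head≤ ys) (Max⁺.x≤y⊔x y _)
  supremum⁺-upper {y ∷ xs} (there x∈xs) = tail≤ x∈xs
    where
    tail≤ : ∀ {ys x} → x List.∈ ys → x ≤⁺ supremum⁺ (y ∷ ys)
    tail≤ {x ∷ ys} (here ≡.refl) = Max⁺.x≤x⊔y x _
    tail≤ {z ∷ ys} (there x∈ys)  = ≤⁺-trans (tail≤ x∈ys) (Max⁺.x≤y⊔x z _)

  supremum⁺-nonNegative : ∀ {xs} → All ([ 0# ] ≤⁺_) xs → [ 0# ] ≤⁺ supremum⁺ xs
  supremum⁺-nonNegative []        = ≤⁺-refl
  supremum⁺-nonNegative {x ∷ xs} (0≤x ∷ _) =
    ≤⁺-trans 0≤x (supremum⁺-upper {x ∷ xs} (here ≡.refl))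

  -- The candidates may miss feasible points as long as each feasible point is
  -- matched by a candidate that is at least as good.
  minimum-exists : ∀ {a b} {A : Set a} {Feasible : Pred A b} (feasible? : Decidable Feasible)
                   (value : A → Carrier) (candidates : List A) →
                   (∀ {x} → Feasible x → ∃ λ y → y List.∈ candidates × Feasible y × value y ≤ value x) →
                   ∃ Feasible → ∃ (IsMinimum Feasible value)
  minimum-exists {Feasible = Feasible} feasible? value candidates improve (x₀ , feasible₀) =
    value best ,
    (best , argmin-all totalOrder value feasible₀ (all-filter feasible? candidates) , ≈.refl) ,
    λ x feasible → let y , y∈ , feasible′ , y≤x = improve feasible in
      ≤-trans (All.lookup (f[argmin]≤f[xs] totalOrder {f = value} x₀ _) (∈-filter⁺ feasible? y∈ feasible′)) y≤x
    where
    best = argmin totalOrder value x₀ (filter feasible? candidates)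

-- Subsets and bipartitions

module _ {n} {S : Subset n} {x : Fin n} where

  ∣S∣≤1⇒unique : x ∈ S → ∣ S ∣ ≤ℕ 1 → ∀ {y} → y ∈ S → y ≡ x
  ∣S∣≤1⇒unique x∈S ∣S∣≤1 {y} y∈S with y ≟ x
  ... | yes y≡x = y≡x
  ... | no  y≢x = contradiction (ℕ.≤-trans (s≤s 1≤∣S-x∣) (ℕ.≤-trans (x∈p⇒∣p-x∣<∣p∣ x∈S) ∣S∣≤1)) λ { (s≤s ()) }
    where
    1≤∣S-x∣ : 1 ≤ℕ ∣ S ∖ x ∣
    1≤∣S-x∣ = ≡.subst (_≤ℕ ∣ S ∖ x ∣) (∣⁅x⁆∣≡1 y) (p⊆q⇒∣p∣≤∣q∣ λ z∈⁅y⁆ →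
      ≡.subst (_∈ S ∖ x) (≡.sym (x∈⁅y⁆⇒x≡y y z∈⁅y⁆)) (x∈p∧x≢y⇒x∈p-y y∈S y≢x))

  singleton : x ∈ S → ∣ S ∣ ≤ℕ 1 → S ≡ ⁅ x ⁆
  singleton x∈S ∣S∣≤1 = ⊆-antisym
    (λ y∈S → ≡.subst (_∈ ⁅ x ⁆) (≡.sym (∣S∣≤1⇒unique x∈S ∣S∣≤1 y∈S)) (x∈⁅x⁆ x))
    (λ y∈⁅x⁆ → ≡.subst (_∈ S) (≡.sym (x∈⁅y⁆⇒x≡y x y∈⁅x⁆)) x∈S)

  second-element : 2 ≤ℕ ∣ S ∣ → ∃ λ y → y ∈ S × y ≢ x
  second-element 2≤∣S∣ with any? (λ y → (y ∈? S) ×-dec ¬? (y ≟ x))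
  ... | yes y = y
  ... | no ∄y = contradiction (ℕ.≤-trans 2≤∣S∣ (ℕ.≤-trans (p⊆q⇒∣p∣≤∣q∣ S⊆⁅x⁆) (ℕ.≤-reflexive (∣⁅x⁆∣≡1 x)))) λ { (s≤s ()) }
    where
    S⊆⁅x⁆ : S ⊆ ⁅ x ⁆
    S⊆⁅x⁆ {y} y∈S with y ≟ x
    ... | yes refl = x∈⁅x⁆ x
    ... | no  y≢x  = contradiction (y , y∈S , y≢x) ∄y

∈-subsets : ∀ {n} (S : Subset n) → S List.∈ subsets n
∈-subsets []          = here refl
∈-subsets {suc n} (true  ∷ S) = ∈-++⁺ˡ (∈-map⁺ (true ∷_) (∈-subsets S))
∈-subsets {suc n} (false ∷ S) = ∈-++⁺ʳ (map (true ∷_) (subsets n)) (∈-map⁺ (false ∷_) (∈-subsets S))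

module Bipartition {n} {S A B : Subset n} (bipartition : IsBipartition S A B) where

  private
    A∪B≡S = proj₁ bipartition
    A∩B≡⊥ = proj₂ bipartition

  A⊆S : A ⊆ S
  A⊆S x∈A = ≡.subst (_ ∈_) A∪B≡S (p⊆p∪q B x∈A)

  B⊆S : B ⊆ S
  B⊆S x∈B = ≡.subst (_ ∈_) A∪B≡S (q⊆p∪q A B x∈B)

  side : ∀ {x} → x ∈ S → x ∈ A ⊎ x ∈ B
  side x∈S = x∈p∪q⁻ A B (≡.subst (_ ∈_) (≡.sym A∪B≡S) x∈S)

  disjoint : ∀ {x} → x ∈ A → x ∉ B
  disjoint x∈A x∈B = ∉⊥ (≡.subst (_ ∈_) A∩B≡⊥ (x∈p∩q⁺ (x∈A , x∈B)))

  does-∪ : ∀ x → does (x ∈? S) ≡ does (x ∈? A) ∨ does (x ∈? B)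
  does-∪ x = does-⇔ (mk⇔ side λ { (inj₁ x∈A) → A⊆S x∈A ; (inj₂ x∈B) → B⊆S x∈B })
    (x ∈? S) (x ∈? A ⊎-dec x ∈? B)

  does-∩ : ∀ x → does (x ∈? A) ∧ does (x ∈? B) ≡ false
  does-∩ x = dec-false (x ∈? A ×-dec x ∈? B) λ (x∈A , x∈B) → disjoint x∈A x∈B

x∉p-x : ∀ {n} (p : Subset n) x → x ∉ p ∖ x
x∉p-x (_ ∷ p) zero    ()
x∉p-x (_ ∷ p) (suc x) (there x∈p-x) = x∉p-x p x x∈p-x

-- Hierarchies and their enumeration

if-elim : ∀ {a b p} {A : Set a} {B : Set b} (P : B → Set p) (a? : Dec A) {t e : B} →
          (A → P t) → P e → P (if does a? then t else e)
if-elim P (yes a) Pt Pe = Pt a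
if-elim P (no _)  Pt Pe = Pe

-- Leaves and nodes store equality proofs. The enumeration below builds
-- its own proofs, which have to be identified with those of a given hierarchy.
≡-irrelevant : ∀ {a} {A : Set a} {x y : A} (p q : x ≡ y) → p ≡ q
≡-irrelevant refl refl = refl

module _ {n : ℕ} where

  hierarchy-nonempty : {S : Subset n} → Hierarchy S → Nonempty S
  hierarchy-nonempty (leaf v S≡⁅v⁆) = v , ≡.subst (v ∈_) (≡.sym S≡⁅v⁆) (x∈⁅x⁆ v)
  hierarchy-nonempty (node AB H K)  = let v , v∈A = hierarchy-nonempty H in v , Bipartition.A⊆S AB v∈A

  lca-∈ : ∀ {P : Subset n → Set} {S} (H : Hierarchy S) → EveryCluster P H → ∀ {x y} → x ∈ S → y ∈ S →
          P (lcaCluster H x y) × x ∈ lcaCluster H x y × y ∈ lcaCluster H x y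
  lca-∈ (leaf _ _) PS x∈S y∈S = PS , x∈S , y∈S
  lca-∈ {P} (node {A} {B} AB H K) (PS , PH , PK) {x} {y} x∈S y∈S =
    if-elim Contains (x ∈? A ×-dec y ∈? A) (λ (x∈A , y∈A) → lca-∈ H PH x∈A y∈A)
      (if-elim Contains (x ∈? B ×-dec y ∈? B) (λ (x∈B , y∈B) → lca-∈ K PK x∈B y∈B)
        (PS , x∈S , y∈S))
    where
    Contains : Subset n → Set
    Contains C = P C × x ∈ C × y ∈ C

  module _ {S A B : Subset n} (AB : IsBipartition S A B) (H : Hierarchy A) (K : Hierarchy B) where
    open Bipartition AB

    lca-left : ∀ {x y} → x ∈ A → y ∈ A → lcaCluster (node AB H K) x y ≡ lcaCluster H x y
    lca-left {x} {y} x∈A y∈A rewrite dec-true (x ∈? A) x∈A | dec-true (y ∈? A) y∈A = refl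

    lca-right : ∀ {x y} → x ∈ B → y ∈ B → lcaCluster (node AB H K) x y ≡ lcaCluster K x y
    lca-right {x} {y} x∈B y∈B
      rewrite dec-false (x ∈? A) (λ x∈A → disjoint x∈A x∈B) | dec-true (x ∈? B) x∈B | dec-true (y ∈? B) y∈B = refl

    lca-across : ∀ {x y} → x ∈ A → y ∈ B →
                 lcaCluster (node AB H K) x y ≡ S × lcaCluster (node AB H K) y x ≡ S
    lca-across {x} {y} x∈A y∈B
      rewrite dec-true (x ∈? A) x∈A | dec-false (y ∈? A) (λ y∈A → disjoint y∈A y∈B)
            | dec-false (x ∈? B) (disjoint x∈A) | dec-true (y ∈? B) y∈B = refl , refl

  leaf? : (S : Subset n) (v : Fin n) → Dec (S ≡ ⁅ v ⁆)
  leaf? S v = Vec.≡-dec Bool._≟_ S ⁅ v ⁆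

  -- The number bounds the cardinality of the clusters still to be split. The
  -- two parts of a node are nonempty, hence smaller than their union, so it
  -- may decrease at every level.
  mutual
    hierarchies : ℕ → (S : Subset n) → List (Hierarchy S)
    hierarchies zero    S = []
    hierarchies (suc m) S = concatMap (leaves S) (allFin n) ++
                            concatMap (nodes m S) (cartesianProduct (subsets n) (subsets n))

    leaves : (S : Subset n) → Fin n → List (Hierarchy S)
    leaves S v with leaf? S v
    ... | yes S≡⁅v⁆ = leaf v S≡⁅v⁆ ∷ []
    ... | no _      = []

    nodes : ℕ → (S : Subset n) → Subset n × Subset n → List (Hierarchy S)
    nodes m S (A , B) with isBipartition? S A B
    ... | yes AB = cartesianProductWith (node AB) (hierarchies m A) (hierarchies m B)
    ... | no _   = []

  hierarchies-complete : ∀ m {S} (H : Hierarchy S) → ∣ S ∣ ≤ℕ m → H List.∈ hierarchies m S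
  hierarchies-complete zero {S} H ∣S∣≤0 =
    let v , v∈S = hierarchy-nonempty H in
    contradiction (ℕ.≤-trans (x∈p⇒∣p-x∣<∣p∣ v∈S) ∣S∣≤0) λ ()
  hierarchies-complete (suc m) {S} (leaf v S≡⁅v⁆) _ =
    ∈-++⁺ˡ (∈-concatMap⁺ (leaves S) (lose (∈-allFin v) ∈-leaves))
    where
    ∈-leaves : leaf v S≡⁅v⁆ List.∈ leaves S v
    ∈-leaves rewrite dec-yes-irr (leaf? S v) ≡-irrelevant S≡⁅v⁆ = here refl
  hierarchies-complete (suc m) {S} (node {A} {B} AB H K) ∣S∣≤1+m =
    ∈-++⁺ʳ (concatMap (leaves S) (allFin n))
      (∈-concatMap⁺ (nodes m S) (lose (∈-cartesianProduct⁺ (∈-subsets A) (∈-subsets B)) ∈-nodes))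
    where
    open Bipartition AB

    A⊂S : A ⊂ S
    A⊂S = let v , v∈B = hierarchy-nonempty K in A⊆S , v , B⊆S v∈B , λ v∈A → disjoint v∈A v∈B

    B⊂S : B ⊂ S
    B⊂S = let v , v∈A = hierarchy-nonempty H in B⊆S , v , A⊆S v∈A , disjoint v∈A

    irrelevant : (p q : IsBipartition S A B) → p ≡ q
    irrelevant (p , q) (p′ , q′) = ≡.cong₂ _,_ (≡-irrelevant p p′) (≡-irrelevant q q′)

    smaller : ∀ {C} → C ⊂ S → ∣ C ∣ ≤ℕ m
    smaller C⊂S = ℕ.s≤s⁻¹ (ℕ.≤-trans (p⊂q⇒∣p∣<∣q∣ C⊂S) ∣S∣≤1+m)

    ∈-nodes : node AB H K List.∈ nodes m S (A , B)
    ∈-nodes rewrite dec-yes-irr (isBipartition? S A B) irrelevant AB =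
      ∈-cartesianProductWith⁺ (node AB) (hierarchies-complete m H (smaller A⊂S)) (hierarchies-complete m K (smaller B⊂S))

-- Finite searches

least : ∀ {p} {P : Pred ℕ p} → Decidable P → ∀ k → P k → ∃ λ d → P d × (∀ l → P l → d ≤ℕ l)
least P? k Pk with P? 0
... | yes P0 = 0 , P0 , λ _ _ → z≤n
least P? zero    Pk | no ¬P0 = contradiction Pk ¬P0
least P? (suc k) Pk | no ¬P0 with least (P? ∘ suc) k Pk
... | d , Pd , d-least = suc d , Pd , λ
  { zero    P0 → contradiction P0 ¬P0
  ; (suc l) Pl → s≤s (d-least l Pl)
  }

functions : ∀ {a} {A : Set a} → List A → ∀ m → List (Fin m → A)
functions xs zero    = (λ ()) ∷ []
functions xs (suc m) = cartesianProductWith _∷ᶠ_ xs (functions xs m)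

-- Agreement is measured by a relation rather than by equality, so that the
-- enumeration can be nested to list binary functions.
functions-complete : ∀ {a b r} {A : Set a} {B : Set b} (_≈_ : REL A B r) {xs m} (f : Fin m → B) →
                     (∀ i → ∃ λ a → a List.∈ xs × a ≈ f i) →
                     ∃ λ g → g List.∈ functions xs m × (∀ i → g i ≈ f i)
functions-complete _≈_ {m = zero}  f lift = _ , here refl , λ ()
functions-complete _≈_ {m = suc m} f lift with lift zero | functions-complete _≈_ (f ∘ suc) (lift ∘ suc)
... | a , a∈ , a≈ | g , g∈ , g≈ =
  a ∷ᶠ g , ∈-cartesianProductWith⁺ _∷ᶠ_ a∈ g∈ , λ { zero → a≈ ; (suc i) → g≈ i }

-- Walks

module _ {n} {_~_ : Rel (Fin n) 0ℓ} where

  walk? : B.Decidable _~_ → ∀ k → B.Decidable (Walk _~_ k)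
  walk? _~?_ zero    x y = map′ (λ { refl → stop }) (λ { stop → refl }) (x ≟ y)
  walk? _~?_ (suc k) x y = map′ (λ (_ , x~z , walk) → step x~z walk)
                                (λ { (step x~z walk) → _ , x~z , walk })
                                (any? λ z → (x ~? z) ×-dec walk? _~?_ k z y)

module Walks {c ℓ₁ ℓ₂} {K : OrderedField c ℓ₁ ℓ₂} {n} (G : WeightedGraph K n) where

  open WeightedGraph G

  -- Cutting a walk after its last visit to v: either it never met v, or it
  -- ends there, or what follows the last visit starts at a neighbour of v.
  after-last-visit : ∀ v {S x y} → Star (Induced G S) x y →
          Star (Induced G (S ∖ v)) x y ⊎
          y ≡ v ⊎
          (∃ λ z → v ~ z × z ∈ S × Star (Induced G (S ∖ v)) z y)
  after-last-visit v ε = inj₁ ε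
  after-last-visit v {x = x} (_◅_ {j = z} (x∈S , z∈S , x~z) walk) with after-last-visit v walk
  ... | inj₂ later = inj₂ later
  ... | inj₁ walk′ with x ≟ v
  ...   | yes refl = inj₂ (inj₂ (z , x~z , z∈S , walk′))
  ...   | no x≢v with z ≟ v
  ...     | no z≢v = inj₁ ((x∈p∧x≢y⇒x∈p-y x∈S x≢v , x∈p∧x≢y⇒x∈p-y z∈S z≢v , x~z) ◅ walk′)
  ...     | yes refl with walk′
  ...       | ε = inj₂ (inj₁ refl)
  ...       | (z∈S-z , _) ◅ _ = contradiction z∈S-z (x∉p-x _ z)

  -- Erasing loops at the start x leaves a walk whose remainder lives in
  -- S without x, so every further step uses up a vertex of S.
  short-walk : ∀ m {S x y} → ∣ S ∣ ≤ℕ suc m → x ∈ S → y ∈ S → Star (Induced G S) x y →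
               ∃ λ k → k ≤ℕ m × Walk _~_ k x y
  short-walk m {S} {x} {y} ∣S∣≤1+m x∈S y∈S walk with y ≟ x
  ... | yes refl = 0 , z≤n , stop
  short-walk zero ∣S∣≤1 x∈S y∈S walk | no y≢x = contradiction (∣S∣≤1⇒unique x∈S ∣S∣≤1 y∈S) y≢x
  short-walk (suc m) {S} {x} {y} ∣S∣≤2+m x∈S y∈S walk | no y≢x with after-last-visit x walk
  ... | inj₁ ε = contradiction refl y≢x
  ... | inj₁ ((x∈S-x , _) ◅ _) = contradiction x∈S-x (x∉p-x S x)
  ... | inj₂ (inj₁ y≡x) = contradiction y≡x y≢x
  ... | inj₂ (inj₂ (z , x~z , z∈S , walk′)) =
    let k , k≤m , walk″ = short-walk m (ℕ.s≤s⁻¹ (ℕ.≤-trans (x∈p⇒∣p-x∣<∣p∣ x∈S) ∣S∣≤2+m))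
                            (x∈p∧x≢y⇒x∈p-y z∈S (λ z≡x → ~-irrefl (≡.sym z≡x) x~z))
                            (x∈p∧x≢y⇒x∈p-y y∈S y≢x) walk′
    in suc k , s≤s k≤m , step x~z walk″

  connected⇒walk : ∀ {S} → Connected G S → ∀ {x y} → x ∈ S → y ∈ S →
                   ∃ λ k → k ≤ℕ ∣ S ∣ ∸ 1 × Walk _~_ k x y
  connected⇒walk (_ , connected) x∈S y∈S = short-walk _ (ℕ.m≤n+m∸n _ 1) x∈S y∈S (connected _ _ x∈S y∈S)

  distance≤ : ∀ {S} → Connected G S → ∀ {x y} → x ∈ S → y ∈ S → ∀ {d} → IsDistance G x y d → d ≤ℕ ∣ S ∣ ∸ 1
  distance≤ connected x∈S y∈S (_ , shortest) =
    let k , k≤ , walk = connected⇒walk connected x∈S y∈S in ℕ.≤-trans (shortest k walk) k≤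

-- Sums over edges

module EdgeSums {c ℓ₁ ℓ₂} {K : OrderedField c ℓ₁ ℓ₂} {n} (G : WeightedGraph K n) where

  open OrderedField K
  open OrderedFieldProperties K
  open WeightedGraph G

  open ≤-Reasoning

  if-nonNegative : ∀ b {t} → 0# ≤ t → 0# ≤ (if b then t else 0#)
  if-nonNegative true  0≤t = 0≤t
  if-nonNegative false 0≤t = ≤-refl

  if-mono-≤ : ∀ {a} {A : Set a} (a? : Dec A) {t u} → (A → t ≤ u) →
              (if does a? then t else 0#) ≤ (if does a? then u else 0#)
  if-mono-≤ (yes a) t≤u = t≤u a
  if-mono-≤ (no _)  t≤u = ≤-refl

  w-sym : ∀ x y → w G x y ≈ w G y x
  w-sym x y with x ~? y | y ~? x
  ... | yes x~y | yes y~x = weight-sym x~y y~x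
  ... | yes x~y | no y≁x  = contradiction (~-sym x~y) y≁x
  ... | no x≁y  | yes y~x = contradiction (~-sym y~x) x≁y
  ... | no _    | no _    = ≈.refl

  w-nonNegative : ∀ x y → 0# ≤ w G x y
  w-nonNegative x y with x ~? y
  ... | yes x~y = proj₁ (weight-pos x~y)
  ... | no _    = ≤-refl

  w-pos : ∀ {x y} → x ~ y → 0# < w G x y
  w-pos {x} {y} x~y with x ~? y
  ... | yes x~y = weight-pos x~y
  ... | no x≁y  = contradiction x~y x≁y

  w*-mono-≤ : ∀ {x y a b} → (x ~ y → a ≤ b) → w G x y * a ≤ w G x y * b
  w*-mono-≤ {x} {y} {a} {b} a≤b with x ~? y
  ... | yes x~y = *-monoˡ-≤ (proj₁ (weight-pos x~y)) (a≤b x~y)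
  ... | no _    = ≤-reflexive (≈.trans (zeroˡ a) (≈.sym (zeroˡ b)))

  edgeSum-mono-≤ : ∀ S {f g} → (∀ {x y} → x <F y → x ∈ S → y ∈ S → x ~ y → f x y ≤ g x y) →
                   edgeSum G S f ≤ edgeSum G S g
  edgeSum-mono-≤ S f≤g = sum-mono-≤ λ x → sum-mono-≤ λ y →
    if-mono-≤ (x <? y ×-dec x ∈? S ×-dec y ∈? S) λ (x<y , x∈S , y∈S) →
      w*-mono-≤ (f≤g x<y x∈S y∈S)

  edgeSum-cong : ∀ S {f g} → (∀ {x y} → x <F y → x ∈ S → y ∈ S → f x y ≈ g x y) →
                 edgeSum G S f ≈ edgeSum G S g
  edgeSum-cong S f≈g = ≤-antisym
    (edgeSum-mono-≤ S λ x<y x∈S y∈S _ → ≤-reflexive (f≈g x<y x∈S y∈S))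
    (edgeSum-mono-≤ S λ x<y x∈S y∈S _ → ≤-reflexive (≈.sym (f≈g x<y x∈S y∈S)))

  module _ (S : Subset n) {f : Fin n → Fin n → Carrier} (0≤f : ∀ x y → 0# ≤ f x y) where

    private
      term : Fin n → Fin n → Carrier
      term x y = if does (x <? y ×-dec x ∈? S ×-dec y ∈? S) then w G x y * f x y else 0#

      term-nonNegative : ∀ x y → 0# ≤ term x y
      term-nonNegative x y = if-nonNegative (does (x <? y ×-dec x ∈? S ×-dec y ∈? S))
        (*-nonNegative (w-nonNegative x y) (0≤f x y))

    edgeSum-nonNegative : 0# ≤ edgeSum G S f
    edgeSum-nonNegative = sum-nonNegative λ x → sum-nonNegative λ y → term-nonNegative x y

    edge≤edgeSum : ∀ {x y} → x <F y → x ∈ S → y ∈ S → w G x y * f x y ≤ edgeSum G S f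
    edge≤edgeSum {x} {y} x<y x∈S y∈S = begin
      w G x y * f x y ≡⟨ ≡.cong (λ b → if b then w G x y * f x y else 0#)
                          (dec-true (x <? y ×-dec x ∈? S ×-dec y ∈? S) (x<y , x∈S , y∈S)) ⟨
      term x y        ≤⟨ term≤sum (term-nonNegative x) y ⟩
      sum (term x)    ≤⟨ term≤sum (λ x → sum-nonNegative (term-nonNegative x)) x ⟩
      edgeSum G S f   ∎

  -- A walk between two distinct vertices of S begins with an edge inside S.
  inner-pos : ∀ {S} → Connected G S → 2 ≤ℕ ∣ S ∣ → 0# < inner G S
  inner-pos {S} ((x , x∈S) , connected) 2≤∣S∣ =
    let y , y∈S , y≢x = second-element {S = S} {x} 2≤∣S∣ in first-edge y≢x (connected x y x∈S y∈S)
    where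
    edge-pos : ∀ {x z} → x <F z → x ∈ S → z ∈ S → x ~ z → 0# < inner G S
    edge-pos x<z x∈S z∈S x~z = <-≤-trans (w-pos x~z)
      (≤-trans (≤-reflexive (≈.sym (*-identityʳ _))) (edge≤edgeSum S (λ _ _ → 0≤1) x<z x∈S z∈S))

    first-edge : ∀ {y} → y ≢ x → Star (Induced G S) x y → 0# < inner G S
    first-edge y≢x ε = contradiction refl y≢x
    first-edge _ (_◅_ {j = z} (x∈S , z∈S , x~z) _) with Fin.<-cmp x z
    ... | B.tri< x<z _ _ = edge-pos x<z x∈S z∈S x~z
    ... | B.tri≈ _ x≡z _ = contradiction x~z (~-irrefl x≡z)
    ... | B.tri> _ _ z<x = edge-pos z<x z∈S x∈S (~-sym x~z)

  private
    ordered : (Fin n → Fin n → Carrier) → Fin n → Fin n → Carrier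
    ordered g x y = if does (x <? y) then g x y + g y x else 0#

  if-+ : ∀ b {t u} → (if b then t else 0#) + (if b then u else 0#) ≈ (if b then t + u else 0#)
  if-+ true  = ≈.refl
  if-+ false = +-identityˡ 0#

  sum₂-cong : {f g : Fin n → Fin n → Carrier} → (∀ x y → f x y ≈ g x y) →
              sum (λ x → sum (f x)) ≈ sum (λ x → sum (g x))
  sum₂-cong f≈g = sum-cong-≋ λ x → sum-cong-≋ (f≈g x)

  sum₂-+ : (f g : Fin n → Fin n → Carrier) →
             sum (λ x → sum (λ y → f x y + g x y)) ≈ sum (λ x → sum (f x)) + sum (λ x → sum (g x))
  sum₂-+ f g = ≈.trans (sum-cong-≋ λ x → ∑-distrib-+ (f x) (g x)) (∑-distrib-+ (λ x → sum (f x)) (λ x → sum (g x)))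

  -- The cut weight runs over ordered pairs, whereas edge sums count each pair
  -- once; off the diagonal, each unordered pair accounts for both orders.
  sum-ordered : (g : Fin n → Fin n → Carrier) → (∀ x → g x x ≈ 0#) →
                sum (λ x → sum (g x)) ≈ sum (λ x → sum (ordered g x))
  sum-ordered g g[x,x]≈0 = begin-equality
    sum (λ x → sum (g x))                            ≈⟨ sum₂-cong trichotomy ⟩
    sum (λ x → sum (λ y → lower x y + upper y x))    ≈⟨ sum₂-+ lower (λ x y → upper y x) ⟩
    sum (λ x → sum (lower x)) + sum (λ x → sum (λ y → upper y x))
                                                     ≈⟨ +-congˡ (∑-comm upper) ⟨
    sum (λ x → sum (lower x)) + sum (λ x → sum (upper x))
                                                     ≈⟨ sum₂-+ lower upper ⟨
    sum (λ x → sum (λ y → lower x y + upper x y))    ≈⟨ sum₂-cong (λ x y → if-+ (does (x <? y)) {g x y} {g y x}) ⟩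
    sum (λ x → sum (ordered g x))                    ∎
    where
    lower upper : Fin n → Fin n → Carrier
    lower x y = if does (x <? y) then g x y else 0#
    upper x y = if does (x <? y) then g y x else 0#

    trichotomy : ∀ x y → g x y ≈ lower x y + upper y x
    trichotomy x y with Fin.<-cmp x y
    ... | B.tri< x<y _ x≯y rewrite dec-true (x <? y) x<y | dec-false (y <? x) x≯y = ≈.sym (+-identityʳ _)
    ... | B.tri≈ x≮x refl _ rewrite dec-false (x <? x) x≮x = ≈.trans (g[x,x]≈0 x) (≈.sym (+-identityʳ _))
    ... | B.tri> x≮y _ y<x rewrite dec-false (x <? y) x≮y | dec-true (y <? x) y<x = ≈.sym (+-identityˡ _)

  -- The summand of edgeSum-split at a pair (x , y). Here p says x < y, while
  -- a, b (and a′, b′) say on which side x (and y) lies; u and u′ stand for the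
  -- weight of the pair read in either order, according to which end is in A.
  split-term : ∀ p a b a′ b′ {s t u u′} → a ∧ b ≡ false → a′ ∧ b′ ≡ false →
               (a ≡ true → b′ ≡ true → t ≈ s * u) → (a′ ≡ true → b ≡ true → t ≈ s * u′) →
               (if p ∧ (a ∨ b) ∧ (a′ ∨ b′) then t else 0#) ≈
               s * (if p then (if a ∧ b′ then u else 0#) + (if a′ ∧ b then u′ else 0#) else 0#) +
               ((if p ∧ a ∧ a′ then t else 0#) + (if p ∧ b ∧ b′ then t else 0#))
  split-term false a b a′ b′ {s} _ _ _ _ = begin-equality
    0#                   ≈⟨ zeroʳ s ⟨
    s * 0#               ≈⟨ +-identityʳ (s * 0#) ⟨
    s * 0# + 0#          ≈⟨ +-congˡ (+-identityˡ 0#) ⟨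
    s * 0# + (0# + 0#)   ∎
  split-term true a b a′ b′ {s} {t} {u} {u′} a∧b a′∧b′ across across′ =
    cases a b a′ b′ a∧b a′∧b′ across across′
    where
    s*0≈0 : s * (0# + 0#) ≈ 0#
    s*0≈0 = ≈.trans (*-congˡ (+-identityˡ 0#)) (zeroʳ s)

    inside-one : ∀ {v v′ v″} → t ≈ v → v′ + v″ ≈ v → t ≈ s * (0# + 0#) + (v′ + v″)
    inside-one {v} {v′} {v″} t≈v v≈ = begin-equality
      t                           ≈⟨ t≈v ⟩
      v                           ≈⟨ v≈ ⟨
      v′ + v″                     ≈⟨ +-identityˡ (v′ + v″) ⟨
      0# + (v′ + v″)              ≈⟨ +-congʳ s*0≈0 ⟨
      s * (0# + 0#) + (v′ + v″)   ∎

    outside-both : 0# ≈ s * (0# + 0#) + (0# + 0#)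
    outside-both = begin-equality
      0#                        ≈⟨ +-identityˡ 0# ⟨
      0# + 0#                   ≈⟨ +-cong s*0≈0 (+-identityˡ 0#) ⟨
      s * (0# + 0#) + (0# + 0#) ∎

    between : ∀ {v v′ v″} → t ≈ s * v → v′ + v″ ≈ v → t ≈ s * (v′ + v″) + (0# + 0#)
    between {v} {v′} {v″} t≈sv v≈ = begin-equality
      t                             ≈⟨ t≈sv ⟩
      s * v                         ≈⟨ *-congˡ v≈ ⟨
      s * (v′ + v″)                 ≈⟨ +-identityʳ (s * (v′ + v″)) ⟨
      s * (v′ + v″) + 0#            ≈⟨ +-congˡ (+-identityˡ 0#) ⟨
      s * (v′ + v″) + (0# + 0#)     ∎

    cases : ∀ a b a′ b′ → a ∧ b ≡ false → a′ ∧ b′ ≡ false →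
            (a ≡ true → b′ ≡ true → t ≈ s * u) → (a′ ≡ true → b ≡ true → t ≈ s * u′) →
            (if (a ∨ b) ∧ (a′ ∨ b′) then t else 0#) ≈
            s * ((if a ∧ b′ then u else 0#) + (if a′ ∧ b then u′ else 0#)) +
            ((if a ∧ a′ then t else 0#) + (if b ∧ b′ then t else 0#))
    cases true  false true  false _ _ _ _ = inside-one ≈.refl (+-identityʳ t)
    cases false true  false true  _ _ _ _ = inside-one ≈.refl (+-identityˡ t)
    cases true  false false true  _ _ across _ = between (across refl refl) (+-identityʳ u)
    cases false true  true  false _ _ _ across′ = between (across′ refl refl) (+-identityˡ u′)
    cases true  false false false _ _ _ _ = outside-both
    cases false true  false false _ _ _ _ = outside-both
    cases false false true  false _ _ _ _ = outside-both
    cases false false false true  _ _ _ _ = outside-both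
    cases false false false false _ _ _ _ = outside-both

  -- An edge inside S lies inside A, inside B, or across, where f is constant.
  edgeSum-split : ∀ {S A B s f} → IsBipartition S A B →
                  (∀ {x y} → x ∈ A → y ∈ B → f x y ≈ s × f y x ≈ s) →
                  edgeSum G S f ≈ s * cut G A B + (edgeSum G A f + edgeSum G B f)
  edgeSum-split {S} {A} {B} {s} {f} AB f≈s = begin-equality
    edgeSum G S f ≈⟨ sum₂-cong split ⟩
    sum (λ x → sum λ y → s * ordered across x y + (within A x y + within B x y))
      ≈⟨ sum₂-+ (λ x y → s * ordered across x y) (λ x y → within A x y + within B x y) ⟩
    sum (λ x → sum λ y → s * ordered across x y) + sum (λ x → sum λ y → within A x y + within B x y)
      ≈⟨ +-cong (≈.trans (sum-cong-≋ λ x → ≈.sym (*-distribˡ-sum s (ordered across x)))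
                         (≈.sym (*-distribˡ-sum s (λ x → sum (ordered across x)))))
                (sum₂-+ (within A) (within B)) ⟩
    s * sum (λ x → sum (ordered across x)) + (edgeSum G A f + edgeSum G B f)
      ≈⟨ +-congʳ (*-congˡ (sum-ordered across across[x,x]≈0)) ⟨
    s * cut G A B + (edgeSum G A f + edgeSum G B f) ∎
    where
    open Bipartition AB

    across : Fin n → Fin n → Carrier
    across x y = if does (x ∈? A ×-dec y ∈? B) then w G x y else 0#

    within : Subset n → Fin n → Fin n → Carrier
    within C x y = if does (x <? y ×-dec x ∈? C ×-dec y ∈? C) then w G x y * f x y else 0#

    across[x,x]≈0 : ∀ x → across x x ≈ 0#
    across[x,x]≈0 x rewrite does-∩ x = ≈.refl

    from-does : ∀ {a} {A : Set a} (a? : Dec A) → does a? ≡ true → A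
    from-does (yes a) _ = a

    split : ∀ x y → within S x y ≈ s * ordered across x y + (within A x y + within B x y)
    split x y rewrite does-∪ x | does-∪ y =
      split-term (does (x <? y)) (does (x ∈? A)) (does (x ∈? B)) (does (y ∈? A)) (does (y ∈? B))
        (does-∩ x) (does-∩ y)
        (λ x∈A y∈B → ≈.trans (*-congˡ (proj₁ (f≈s (from-does (x ∈? A) x∈A) (from-does (y ∈? B) y∈B)))) (*-comm _ s))
        (λ y∈A x∈B → ≈.trans (*-cong (w-sym x y) (proj₂ (f≈s (from-does (y ∈? A) y∈A) (from-does (x ∈? B) x∈B)))) (*-comm _ s))

-- Fragmentation and the connected hierarchy

module Fragmentation {c ℓ₁ ℓ₂} {K : OrderedField c ℓ₁ ℓ₂} {n} (G : WeightedGraph K n) where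

  open OrderedField K
  open OrderedFieldProperties K
  open EdgeSums G

  open ≤-Reasoning

  cut-nonNegative : ∀ A B → 0# ≤ cut G A B
  cut-nonNegative A B = sum-nonNegative λ x → sum-nonNegative λ y →
    if-nonNegative (does (x ∈? A ×-dec y ∈? B)) (w-nonNegative x y)

  size-1-nonNegative : ∀ S → 0# ≤ size-1 G S
  size-1-nonNegative S = fromℕ-nonNegative (∣ S ∣ ∸ 1)

  size-1-pos⇒2≤ : ∀ {S} → 0# < size-1 G S → 2 ≤ℕ ∣ S ∣
  size-1-pos⇒2≤ {S} = 2≤ ∣ S ∣
    where
    2≤ : ∀ k → 0# < fromℕ (k ∸ 1) → 2 ≤ℕ k
    2≤ zero          0<0 = contradiction ≈.refl (proj₂ 0<0)
    2≤ (suc zero)    0<0 = contradiction ≈.refl (proj₂ 0<0)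
    2≤ (suc (suc k)) _   = s≤s (s≤s z≤n)

  subtreeCost : ∀ {S} → Hierarchy S → Carrier
  subtreeCost {S} H = edgeSum G S λ x y → size-1 G (lcaCluster H x y)

  -- The split of an edge sum, for the constant function 1.
  inner-superadditive : ∀ {S A B} → IsBipartition S A B → inner G A + inner G B ≤ inner G S
  inner-superadditive {S} {A} {B} AB = begin
    inner G A + inner G B                     ≤⟨ x≤y+x (*-nonNegative 0≤1 (cut-nonNegative A B)) ⟩
    1# * cut G A B + (inner G A + inner G B)  ≈⟨ edgeSum-split AB (λ _ _ → ≈.refl , ≈.refl) ⟨
    inner G S                                 ∎

  subtreeCost-leaf : ∀ v {S} (S≡⁅v⁆ : S ≡ ⁅ v ⁆) → subtreeCost (leaf v S≡⁅v⁆) ≤ inner G S * 0#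
  subtreeCost-leaf v {S} S≡⁅v⁆ = begin
    subtreeCost (leaf v S≡⁅v⁆)           ≈⟨ sum₂-cong (λ x y → if-zero _ (w*size≈0 x y)) ⟩
    sum {n} (λ _ → sum {n} (λ _ → 0#))   ≈⟨ sum-cong-≋ {n} (λ _ → sum-replicate-zero n) ⟩
    sum {n} (λ _ → 0#)                   ≈⟨ sum-replicate-zero n ⟩
    0#                                   ≈⟨ zeroʳ (inner G S) ⟨
    inner G S * 0#                       ∎
    where
    w*size≈0 : ∀ x y → w G x y * size-1 G S ≈ 0#
    w*size≈0 x y rewrite S≡⁅v⁆ | ∣⁅x⁆∣≡1 v = zeroʳ (w G x y)

    if-zero : ∀ b {t} → t ≈ 0# → (if b then t else 0#) ≈ 0#
    if-zero true  t≈0 = t≈0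
    if-zero false _   = ≈.refl

  subtreeCost-node : ∀ {S A B} (AB : IsBipartition S A B) (H : Hierarchy A) (H′ : Hierarchy B) →
                     subtreeCost (node AB H H′) ≈
                     size-1 G S * cut G A B + (subtreeCost H + subtreeCost H′)
  subtreeCost-node {S} {A} {B} AB H H′ = ≈.trans
    (edgeSum-split AB λ x∈A y∈B →
      let xy≡S , yx≡S = lca-across AB H H′ x∈A y∈B in size-cong xy≡S , size-cong yx≡S)
    (+-congˡ (+-cong
      (edgeSum-cong A λ _ x∈A y∈A → size-cong (lca-left AB H H′ x∈A y∈A))
      (edgeSum-cong B λ _ x∈B y∈B → size-cong (lca-right AB H H′ x∈B y∈B))))
    where
    size-cong : ∀ {C D} → C ≡ D → size-1 G C ≈ size-1 G D
    size-cong C≡D = ≈.reflexive (≡.cong (size-1 G) C≡D)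

  module _ (α : Carrier) (0<q : 0# < 1# - α) where

    private
      q = 1# - α
      N = fromℕ (n ∸ 1)

    ratio : Subset n → Subset n × Subset n → Carrier
    ratio S (A , B) = (size-1 G S * cut G A B) ÷ inner G S

    bipartitions : List (Subset n × Subset n)
    bipartitions = cartesianProduct (subsets n) (subsets n)

    ratios : Subset n → List (Carrier ⁺)
    ratios S = map ([_] ∘ ratio S) (filter (isFragmentation? G α S) bipartitions)

    frag-attained : ∀ {S r} → frag G α S ≡ [ r ] →
                    ∃₂ λ A B → IsFragmentation G α S (A , B) × r ≡ ratio S (A , B)
    frag-attained {S} frag≡r =
      let (A , B) , _ , r≡ , isFragmentation =
            ∈-map∘filter⁻ ([_] ∘ ratio S) (isFragmentation? G α S) {xs = bipartitions} (minimum⁺-attained (ratios S) frag≡r)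
      in A , B , isFragmentation , []-injective r≡
      where
      []-injective : ∀ {x y : Carrier} → [ x ] ≡ [ y ] → x ≡ y
      []-injective refl = refl

    inScale⇒2≤ : ∀ j {S} → InScale G α j S → 2 ≤ℕ ∣ S ∣
    inScale⇒2≤ j {S} (_ , small< , _) = size-1-pos⇒2≤ {S} (≤-<-trans 0≤small small<)
      where
      0≤small : 0# ≤ q ^ suc j * N
      0≤small = *-nonNegative (^-nonNegative (suc j) (proj₁ 0<q)) (fromℕ-nonNegative (n ∸ 1))

    frag≤κ : ∀ j {r S} → κ G α j ≡ [ r ] → InScale G α j S → ∃ λ r′ → frag G α S ≡ [ r′ ] × r′ ≤ r
    frag≤κ j {r} {S} κ≡r inScale = lower (≡.subst (_ ≤⁺_) κ≡r
      (supremum⁺-upper (∈-map∘filter⁺ (frag G α) (inScale? G α j) {xs = subsets n} (S , ∈-subsets S , refl , inScale))))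
      where
      lower : ∀ {x} → x ≤⁺ [ r ] → ∃ λ r′ → x ≡ [ r′ ] × r′ ≤ r
      lower [ r′≤r ]≤ = _ , refl , r′≤r

    -- Scales holding no cluster have supremum 0; otherwise every ratio has a
    -- positive denominator, because clusters in a scale have an edge.
    κ-nonNegative : ∀ j {r} → κ G α j ≡ [ r ] → 0# ≤ r
    κ-nonNegative j {r} κ≡r = unlift (≡.subst (_ ≤⁺_) κ≡r
      (supremum⁺-nonNegative (All.tabulate frags-nonNegative)))
      where
      unlift : ∀ {x} → [ 0# ] ≤⁺ [ x ] → 0# ≤ x
      unlift [ 0≤x ]≤ = 0≤x

      frags-nonNegative : ∀ {x} → x List.∈ map (frag G α) (filter (inScale? G α j) (subsets n)) → [ 0# ] ≤⁺ x
      frags-nonNegative x∈ with ∈-map∘filter⁻ (frag G α) (inScale? G α j) {xs = subsets n} x∈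
      ... | S , _ , refl , inScale@(connected , _) = minimum⁺-nonNegative {ratios S} (All.tabulate ratio-nonNegative)
        where
        ratio-nonNegative : ∀ {x} → x List.∈ ratios S → [ 0# ] ≤⁺ x
        ratio-nonNegative x∈ with ∈-map∘filter⁻ ([_] ∘ ratio S) (isFragmentation? G α S) {xs = bipartitions} x∈
        ... | (A , B) , _ , refl , _ =
          [ ÷-nonNegative (*-nonNegative (size-1-nonNegative S) (cut-nonNegative A B))
                          (inner-pos connected (inScale⇒2≤ j {S} inScale)) ]≤

    -- Induction on the number m of scales from j on. A cluster either already
    -- satisfies the size bound of scale j + 1, in which case κ_j is only added
    -- as a nonnegative slack, or it lies in scale j and is split optimally.
    hierarchy-below : ∀ m j (r : Fin m → Carrier) → (∀ i → κ G α (j ℕ.+ toℕ i) ≡ [ r i ]) →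
                      q ^ (j ℕ.+ m) * N < 1# →
                      ∀ {S} → Connected G S → size-1 G S ≤ q ^ j * N →
                      ∃ λ (H : Hierarchy S) → EveryCluster (Connected G) H × subtreeCost H ≤ inner G S * sum r
    hierarchy-below zero j r _ q^jN<1 {S} connected@((v , v∈S) , _) size≤ =
      leaf v S≡⁅v⁆ , connected , subtreeCost-leaf v S≡⁅v⁆
      where
      size≡0 : ∣ S ∣ ∸ 1 ≡ 0
      size≡0 = fromℕ<1⇒≡0 (≤-<-trans (≡.subst (λ k → size-1 G S ≤ q ^ k * N) (≡.sym (ℕ.+-identityʳ j)) size≤) q^jN<1)

      S≡⁅v⁆ : S ≡ ⁅ v ⁆
      S≡⁅v⁆ = singleton v∈S (ℕ.m∸n≡0⇒m≤n size≡0)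
    hierarchy-below (suc m) j r κ≡r q^jN<1 {S} connected size≤ = skip-or-split (size-1 G S ≤? q ^ suc j * N)
      where
      κ≡r′ : ∀ i → κ G α (suc j ℕ.+ toℕ i) ≡ [ r (suc i) ]
      κ≡r′ i = ≡.trans (≡.cong (κ G α) (≡.sym (ℕ.+-suc j (toℕ i)))) (κ≡r (suc i))

      κ≡r₀ : κ G α j ≡ [ r zero ]
      κ≡r₀ = ≡.trans (≡.cong (κ G α) (≡.sym (ℕ.+-identityʳ j))) (κ≡r zero)

      finer : ∀ {A} → Connected G A → size-1 G A ≤ q ^ suc j * N →
              ∃ λ (H : Hierarchy A) → EveryCluster (Connected G) H × subtreeCost H ≤ inner G A * sum (r ∘ suc)
      finer = hierarchy-below m (suc j) (r ∘ suc) κ≡r′ (≡.subst (λ k → q ^ k * N < 1#) (ℕ.+-suc j m) q^jN<1)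

      skip-or-split : Dec (size-1 G S ≤ q ^ suc j * N) →
             ∃ λ (H : Hierarchy S) → EveryCluster (Connected G) H × subtreeCost H ≤ inner G S * sum r
      skip-or-split (yes small) =
        let H , H-connected , cost≤ = finer connected small in
        H , H-connected , (begin
          subtreeCost H                ≤⟨ cost≤ ⟩
          inner G S * sum (r ∘ suc)    ≤⟨ *-monoˡ-≤ (edgeSum-nonNegative S λ _ _ → 0≤1) (x≤y+x (κ-nonNegative j κ≡r₀)) ⟩
          inner G S * sum r            ∎)
      skip-or-split (no large) =
        let inScale = connected , ≰⇒> large , size≤
            s , frag≡s , s≤r₀ = frag≤κ j κ≡r₀ inScale
            A , B , (AB , A-connected , B-connected , balanced) , s≡ = frag-attained {S} frag≡s
            max≤ = begin
              max (size-1 G A) (size-1 G B) ≤⟨ balanced ⟩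
              q * size-1 G S                ≤⟨ *-monoˡ-≤ (proj₁ 0<q) size≤ ⟩
              q * (q ^ j * N)               ≈⟨ *-assoc q (q ^ j) N ⟨
              q ^ suc j * N                 ∎
            H , H-connected , H-cost  = finer A-connected (≤-trans (x≤x⊔y (size-1 G A) (size-1 G B)) max≤)
            H′ , H′-connected , H′-cost = finer B-connected (≤-trans (x≤y⊔x (size-1 G A) (size-1 G B)) max≤)
            R = sum (r ∘ suc)
            W = inner G S
        in node AB H H′ , (connected , H-connected , H′-connected) , (begin
          subtreeCost (node AB H H′)
            ≈⟨ subtreeCost-node AB H H′ ⟩
          size-1 G S * cut G A B + (subtreeCost H + subtreeCost H′)
            ≤⟨ +-mono-≤ (x÷y≤z⇒x≤y*z (inner-pos connected (inScale⇒2≤ j {S} inScale)) (≤-trans (≤-reflexive (≈.reflexive (≡.sym s≡))) s≤r₀))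
                        (+-mono-≤ H-cost H′-cost) ⟩
          W * r zero + (inner G A * R + inner G B * R)
            ≈⟨ +-congˡ (distribʳ R (inner G A) (inner G B)) ⟨
          W * r zero + (inner G A + inner G B) * R
            ≤⟨ +-monoʳ-≤ (W * r zero) (*-monoʳ-≤ (sum-nonNegative λ i → κ-nonNegative (suc j ℕ.+ toℕ i) (κ≡r′ i)) (inner-superadditive AB)) ⟩
          W * r zero + W * R
            ≈⟨ distribˡ W (r zero) R ⟨
          W * sum r ∎)
        where open Max totalOrder using (x≤x⊔y; x≤y⊔x)

-- The two optima

module Optima {c ℓ₁ ℓ₂} {K : OrderedField c ℓ₁ ℓ₂} {n} (G : WeightedGraph K n) (connected : Connected G ⊤) where

  open OrderedField K
  open OrderedFieldProperties K
  open Walks G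
  open EdgeSums G
  open WeightedGraph G
  open Max totalOrder using (x≤x⊔y; x≤y⊔x; ⊔-sel)
  open Metric {A = Fin n} _≡_ _≈_ _≤_ 0# using (module IsGeneralMetric)

  distance-exists : ∀ x y → ∃ (IsDistance G x y)
  distance-exists x y = let k , _ , walk = connected⇒walk connected ∈⊤ ∈⊤ in
    least (λ k → walk? _~?_ k x y) k walk

  dist : Fin n → Fin n → ℕ
  dist x y = proj₁ (distance-exists x y)

  dist≤n-1 : ∀ {x y d} → IsDistance G x y d → d ≤ℕ n ∸ 1
  dist≤n-1 isDistance = ≡.subst (λ k → _ ≤ℕ k ∸ 1) (∣⊤∣≡n n) (distance≤ connected ∈⊤ ∈⊤ isDistance)

  dominates? : (u : Fin n → Fin n → Carrier) → Dec (DominatesDistance G u)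
  dominates? u = map′
    (λ dist≤u x y d (_ , shortest) → ≤-trans (fromℕ-mono-≤ (shortest _ (proj₁ (proj₂ (distance-exists x y))))) (dist≤u x y))
    (λ dominates x y → dominates x y (dist x y) (proj₂ (distance-exists x y)))
    (all? λ x → all? λ y → fromℕ (dist x y) ≤? u x y)

  dominates⇒1≤ : ∀ {u} → DominatesDistance G u → ∀ {x y} → x ≢ y → 1# ≤ u x y
  dominates⇒1≤ dominates {x} {y} x≢y with distance-exists x y
  ... | zero  , stop , _   = contradiction refl x≢y
  ... | suc d , isDistance = ≤-trans (1≤fromℕ-suc d) (dominates x y (suc d) isDistance)

  isUltrametric : {u : Fin n → Fin n → Carrier} →
                  (∀ x y → 0# ≤ u x y) → (∀ x → u x x ≈ 0#) → (∀ x y → u x y ≈ 0# → x ≡ y) →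
                  (∀ x y → u x y ≈ u y x) → (∀ x y z → u x z ≤ max (u x y) (u y z)) →
                  IsUltrametric G u
  isUltrametric nonNegative u[x,x]≈0 u≈0⇒≡ symmetric triangle = record
    { isSemiMetric = record
      { isQuasiSemiMetric = record
        { isPreMetric = record
          { isProtoMetric = record
            { isPartialOrder  = TotalOrder.isPartialOrder totalOrder
            ; ≈-isEquivalence = ≡.isEquivalence
            ; cong            = λ { refl refl → ≈.refl }
            ; nonNegative     = nonNegative _ _
            }
          ; ≈⇒0 = λ { refl → u[x,x]≈0 _ }
          }
        ; 0⇒≈ = u≈0⇒≡ _ _
        }
      ; sym = symmetric
      }
    ; triangle = triangle
    }

  isUltrametric? : (u : Fin n → Fin n → Carrier) → Dec (IsUltrametric G u)
  isUltrametric? u = map′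
    (λ (nonNegative , u[x,x]≈0 , u≈0⇒≡ , symmetric , triangle) →
      isUltrametric nonNegative u[x,x]≈0 u≈0⇒≡ symmetric triangle)
    (λ ultrametric → let open IsGeneralMetric ultrametric hiding (refl) in
      (λ _ _ → nonNegative) , (λ _ → ≈⇒0 refl) , (λ _ _ → 0⇒≈) , sym , triangle)
    ((all? λ x → all? λ y → 0# ≤? u x y) ×-dec
     (all? λ x → u x x ≈? 0#) ×-dec
     (all? λ x → all? λ y → (u x y ≈? 0#) →-dec (x ≟ y)) ×-dec
     (all? λ x → all? λ y → u x y ≈? u y x) ×-dec
     (all? λ x → all? λ y → all? λ z → u x z ≤? max (u x y) (u y z)))

  Admissible : (Fin n → Fin n → Carrier) → Set _
  Admissible u = IsUltrametric G u × DominatesDistance G u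

  -- Definiteness comes for free from domination, since distinct vertices are
  -- at distance at least 1.
  ℕ-admissible : {v : Fin n → Fin n → ℕ} →
                 (∀ x → v x x ≡ 0) → (∀ x y → v x y ≡ v y x) →
                 (∀ x y z → v x z ≤ℕ v x y ⊎ v x z ≤ℕ v y z) →
                 (∀ x y d → IsDistance G x y d → d ≤ℕ v x y) →
                 Admissible (λ x y → fromℕ (v x y))
  ℕ-admissible {v} v[x,x]≡0 symmetric triangle dominates =
    isUltrametric
      (λ x y → fromℕ-nonNegative (v x y))
      (λ x → ≈.reflexive (≡.cong fromℕ (v[x,x]≡0 x)))
      v≈0⇒≡
      (λ x y → ≈.reflexive (≡.cong fromℕ (symmetric x y)))
      (λ x y z → triangle′ x y z (triangle x y z)) ,
    λ x y d isDistance → fromℕ-mono-≤ (dominates x y d isDistance)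
    where
    v≈0⇒≡ : ∀ x y → fromℕ (v x y) ≈ 0# → x ≡ y
    v≈0⇒≡ x y v≈0 with distance-exists x y
    ... | zero  , stop , _ = refl
    ... | suc d , isDistance = contradiction
      (≤-trans (1≤fromℕ-suc d) (≤-trans (fromℕ-mono-≤ (dominates x y _ isDistance)) (≤-reflexive v≈0))) 1≰0

    triangle′ : ∀ x y z → v x z ≤ℕ v x y ⊎ v x z ≤ℕ v y z → fromℕ (v x z) ≤ max (fromℕ (v x y)) (fromℕ (v y z))
    triangle′ x y z (inj₁ v≤v) = ≤-trans (fromℕ-mono-≤ v≤v) (x≤x⊔y _ _)
    triangle′ x y z (inj₂ v≤v) = ≤-trans (fromℕ-mono-≤ v≤v) (x≤y⊔x _ _)

  discrete : Fin n → Fin n → ℕ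
  discrete x y = if does (x ≟ y) then 0 else n ∸ 1

  -- Shows that the feasible region of OPTfree is nonempty.
  discrete-admissible : Admissible (λ x y → fromℕ (discrete x y))
  discrete-admissible = ℕ-admissible {discrete} discrete[x,x]≡0 symmetric triangle dominates
    where
    discrete[x,x]≡0 : ∀ x → discrete x x ≡ 0
    discrete[x,x]≡0 x rewrite dec-true (x ≟ x) refl = refl

    symmetric : ∀ x y → discrete x y ≡ discrete y x
    symmetric x y = ≡.cong (λ b → if b then 0 else n ∸ 1) (does-⇔ (mk⇔ ≡.sym ≡.sym) (x ≟ y) (y ≟ x))

    triangle : ∀ x y z → discrete x z ≤ℕ discrete x y ⊎ discrete x z ≤ℕ discrete y z
    triangle x y z with x ≟ y
    ... | yes refl = inj₂ ℕ.≤-refl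
    ... | no _ with x ≟ z
    ...   | yes _ = inj₁ z≤n
    ...   | no _ = inj₁ ℕ.≤-refl

    dominates : ∀ x y d → IsDistance G x y d → d ≤ℕ discrete x y
    dominates x y d isDistance with x ≟ y
    ... | yes refl = proj₂ isDistance 0 stop
    ... | no _     = dist≤n-1 isDistance

  -- An integer k ≤ n - 1 is at most min(n - 1, ⌊t⌋) exactly when k ≤ t. The
  -- conditions on the rounded function compare it with such an integer: its
  -- own value in the strong triangle inequality, a distance for domination.
  floor-admissible : {u : Fin n → Fin n → Carrier} {v : Fin n → Fin n → ℕ} →
                     Admissible u → (∀ x y → v x y ≡ floor (n ∸ 1) (u x y)) →
                     Admissible (λ x y → fromℕ (v x y))
  floor-admissible {u} {v} (ultrametric , dominates) v≡⌊u⌋ =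
    ℕ-admissible {v} v[x,x]≡0 symmetric′ triangle′ dominates′
    where
    open IsGeneralMetric ultrametric using (nonNegative; ≈⇒0; sym; triangle)

    v≤u : ∀ x y → fromℕ (v x y) ≤ u x y
    v≤u x y rewrite v≡⌊u⌋ x y = fromℕ-floor≤ (n ∸ 1) nonNegative

    largest : ∀ {k} x y → k ≤ℕ n ∸ 1 → fromℕ k ≤ u x y → k ≤ℕ v x y
    largest x y rewrite v≡⌊u⌋ x y = ≤floor

    v≤n-1 : ∀ x y → v x y ≤ℕ n ∸ 1
    v≤n-1 x y rewrite v≡⌊u⌋ x y = floor≤ (n ∸ 1) (u x y)

    v[x,x]≡0 : ∀ x → v x x ≡ 0
    v[x,x]≡0 x = fromℕ<1⇒≡0 (≰⇒> λ 1≤v → 1≰0 (≤-trans 1≤v (≤-trans (v≤u x x) (≤-reflexive (≈⇒0 refl)))))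

    v≤vᵒ : ∀ x y → v x y ≤ℕ v y x
    v≤vᵒ x y = largest y x (v≤n-1 x y) (≤-trans (v≤u x y) (≤-reflexive (sym x y)))

    symmetric′ : ∀ x y → v x y ≡ v y x
    symmetric′ x y = ℕ.≤-antisym (v≤vᵒ x y) (v≤vᵒ y x)

    triangle′ : ∀ x y z → v x z ≤ℕ v x y ⊎ v x z ≤ℕ v y z
    triangle′ x y z with ⊔-sel (u x y) (u y z)
    ... | inj₁ max≈ = inj₁ (largest x y (v≤n-1 x z) (≤-trans (v≤u x z) (≤-trans (triangle x y z) (≤-reflexive max≈))))
    ... | inj₂ max≈ = inj₂ (largest y z (v≤n-1 x z) (≤-trans (v≤u x z) (≤-trans (triangle x y z) (≤-reflexive max≈))))

    dominates′ : ∀ x y d → IsDistance G x y d → d ≤ℕ v x y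
    dominates′ x y d isDistance = largest x y (dist≤n-1 isDistance) (dominates x y d isDistance)

  -- Inside their least common cluster C, x and y are joined by a path of length
  -- at most |C| - 1.
  connected⇒dominates : (T : Hierarchy ⊤) → IsConnectedHierarchy G T → DominatesDistance G (heightᵣ G T)
  connected⇒dominates T T-connected x y d isDistance = fromℕ-mono-≤ d≤height
    where
    d≤height : d ≤ℕ height T x y
    d≤height with x ≟ y
    ... | yes refl = proj₂ isDistance 0 stop
    ... | no _     =
      let C-connected , x∈C , y∈C = lca-∈ T T-connected ∈⊤ ∈⊤ in
      distance≤ C-connected x∈C y∈C isDistance

  edgeSum-height≈cost : ∀ T → edgeSum G ⊤ (heightᵣ G T) ≈ cost G T
  edgeSum-height≈cost T = edgeSum-cong ⊤ λ x<y _ _ → height≈ (Fin.<⇒≢ x<y)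
    where
    height≈ : ∀ {x y} → x ≢ y → heightᵣ G T x y ≈ size-1 G (lcaCluster T x y)
    height≈ {x} {y} x≢y rewrite dec-false (x ≟ y) x≢y = ≈.refl

  OPTcard-exists : (T : Hierarchy ⊤) → DominatesDistance G (heightᵣ G T) → ∃ (IsOPTcard G)
  OPTcard-exists T dominates = minimum-exists (λ H → dominates? (heightᵣ G H)) _ (hierarchies n ⊤)
    (λ {H} feasible → H , hierarchies-complete n H (ℕ.≤-reflexive (∣⊤∣≡n n)) , feasible , ≤-refl)
    (T , dominates)

  OPTfree-exists : ∃ (IsOPTfree G)
  OPTfree-exists = minimum-exists
    (λ u → isUltrametric? u ×-dec dominates? u)
    (edgeSum G ⊤) (map toReal tables) improve (_ , discrete-admissible)
    where
    N : ℕ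
    N = n ∸ 1

    toReal : (Fin n → Fin n → ℕ) → Fin n → Fin n → Carrier
    toReal v x y = fromℕ (v x y)

    tables : List (Fin n → Fin n → ℕ)
    tables = functions (functions (upTo (suc N)) n) n

    improve : ∀ {u} → Admissible u →
              ∃ λ u′ → u′ List.∈ map toReal tables × Admissible u′ × edgeSum G ⊤ u′ ≤ edgeSum G ⊤ u
    improve {u} admissible =
      toReal v , ∈-map⁺ toReal v∈tables , floor-admissible admissible v≡⌊u⌋ ,
      edgeSum-mono-≤ ⊤ λ {x} {y} _ _ _ _ → v≤u x y
      where
      ⌊u⌋ : Fin n → Fin n → ℕ
      ⌊u⌋ x y = floor N (u x y)

      table : ∃ λ v → v List.∈ tables × (∀ x y → v x y ≡ ⌊u⌋ x y)
      table = functions-complete (λ f g → ∀ y → f y ≡ g y) ⌊u⌋ λ x →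
        functions-complete _≡_ (⌊u⌋ x) λ y →
          ⌊u⌋ x y , ∈-upTo⁺ (s≤s (floor≤ N (u x y))) , refl

      v = proj₁ table
      v∈tables = proj₁ (proj₂ table)
      v≡⌊u⌋ = proj₂ (proj₂ table)

      v≤u : ∀ x y → toReal v x y ≤ u x y
      v≤u x y rewrite v≡⌊u⌋ x y = fromℕ-floor≤ N nonNegative
        where
        open IsGeneralMetric (proj₁ admissible) using (nonNegative)

  -- The two ends of an edge are distinct, so u is at least 1 on it.
  totalWeight≤OPTfree : ∀ {OPTfree} → IsOPTfree G OPTfree → totalWeight G ≤ OPTfree
  totalWeight≤OPTfree ((u , (_ , dominates) , value≈) , _) = ≤-trans
    (edgeSum-mono-≤ ⊤ λ x<y _ _ _ → dominates⇒1≤ {u} dominates (Fin.<⇒≢ x<y))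
    (≤-reflexive value≈)

theorem9 : ∀ {c ℓ₁ ℓ₂} (ℝ : RealField c ℓ₁ ℓ₂) → let open RealField ℝ in
    ∀ {n : ℕ} → 2 ≤ℕ n →
    (G : WeightedGraph orderedField n) → Connected G ⊤ →
    (α : Carrier) → 0# < α → α ≤ fromℕ 2 ⁻¹ →
    (J : ℕ) → IsFloorLog ((1# - α) ⁻¹) (fromℕ (n ∸ 1)) J →
    (κ<∞ : (j : Fin (suc J)) → Finite (κ G α (toℕ j))) →
    let Σκ = sum (λ j → proj₁ (κ<∞ j)) in
    (∃ λ (T : Hierarchy ⊤) →
    IsConnectedHierarchy G T × cost G T ≤ totalWeight G * Σκ) ×
    (∃ λ OPTcard → ∃ λ OPTfree →
    IsOPTcard G OPTcard × IsOPTfree G OPTfree × OPTcard ÷ OPTfree ≤ Σκ)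
theorem9 ℝ {n} 2≤n G connected α _ α≤½ J (_ , N<b^1+J) κ<∞ =
  (T , T-connected , cost≤) ,
  OPTcard , OPTfree , isOPTcard , isOPTfree , x≤z*y⇒x÷y≤z 0<OPTfree OPTcard≤
  where
  open RealField ℝ
  open OrderedFieldProperties orderedField
  open EdgeSums G
  open Fragmentation G
  open Optima G connected
  open ≤-Reasoning

  Σκ = sum (λ j → proj₁ (κ<∞ j))

  0<q : 0# < 1# - α
  0<q = x<1⇒0<1-x (≤-<-trans α≤½ ½<1)

  Σκ-nonNegative : 0# ≤ Σκ
  Σκ-nonNegative = sum-nonNegative λ j → κ-nonNegative α 0<q (toℕ j) (proj₂ (κ<∞ j))

  size⊤≤N : size-1 G ⊤ ≤ 1# * fromℕ (n ∸ 1)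
  size⊤≤N rewrite ∣⊤∣≡n n = ≤-reflexive (≈.sym (*-identityˡ _))

  connectedHierarchy : ∃ λ (T : Hierarchy ⊤) → IsConnectedHierarchy G T × cost G T ≤ totalWeight G * Σκ
  connectedHierarchy = hierarchy-below α 0<q (suc J) 0 (λ j → proj₁ (κ<∞ j)) (λ j → proj₂ (κ<∞ j))
    (<[x⁻¹]^k⇒x^k*y<1 (suc J) 0<q N<b^1+J) connected size⊤≤N

  T = proj₁ connectedHierarchy
  T-connected = proj₁ (proj₂ connectedHierarchy)
  cost≤ = proj₂ (proj₂ connectedHierarchy)

  card : ∃ (IsOPTcard G)
  card = OPTcard-exists T (connected⇒dominates T T-connected)

  OPTcard = proj₁ card
  isOPTcard = proj₂ card
  OPTfree = proj₁ OPTfree-exists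
  isOPTfree = proj₂ OPTfree-exists

  0<OPTfree : 0# < OPTfree
  0<OPTfree = <-≤-trans (inner-pos connected (≡.subst (2 ≤ℕ_) (≡.sym (∣⊤∣≡n n)) 2≤n)) (totalWeight≤OPTfree isOPTfree)

  OPTcard≤ : OPTcard ≤ Σκ * OPTfree
  OPTcard≤ = begin
    OPTcard                     ≤⟨ proj₂ isOPTcard T (connected⇒dominates T T-connected) ⟩
    edgeSum G ⊤ (heightᵣ G T)   ≈⟨ edgeSum-height≈cost T ⟩
    cost G T                    ≤⟨ cost≤ ⟩
    totalWeight G * Σκ          ≤⟨ *-monoʳ-≤ Σκ-nonNegative (totalWeight≤OPTfree isOPTfree) ⟩
    OPTfree * Σκ                ≈⟨ *-comm OPTfree Σκ ⟩
    Σκ * OPTfree                ∎
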